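{- Let $P\subseteq W=\mathbb{R}^d$ be a $d$-polytope. Then all the identities $\mathrm{ID}(P;\mathcal{C})$ with $\mathcal{C}\in\tilde{\mathcal{C}}_0(P)$ are implied by the identities $\mathrm{ID}(P;\mathcal{C})$ where $\mathcal{C}$ is a minimal element of the poset $(\tilde{\mathcal{A}}_0(P),\preceq)$; that is, if $\prod_{F\in\mathcal{C}}([P]-[F])=0$ in $M(\mathcal{P}(W))$ for every minimal element $\mathcal{C}$ of $(\tilde{\mathcal{A}}_0(P),\preceq)$, then $\prod_{F\in\mathcal{C}}([P]-[F])=0$ in $M(\mathcal{P}(W))$ for every $\mathcal{C}\in\tilde{\mathcal{C}}_0(P)$.
   Context: For $S\subseteq W=\mathbb{R}^d$, $[S]:W\to\mathbb{C}$ denotes its indicator function. $M(\mathcal{P}(W))$ is the complex vector space of functions on $W$ spanned by indicator functions of closed convex polyhedra, a commutative $\mathbb{C}$-algebra with the well-defined bilinear product determined by $[A]\cdot[B]=[A+B]$ (Minkowski sum) for nonempty closed convex polyhedra, with unit $[\{0\}]$. For a polytope $P$, let $\mathcal{F}(P)$ be the set of its nonempty proper faces, and let $\tilde{\mathcal{C}}_0(P)$ be the collection of all $\mathcal{C}\subseteq\mathcal{F}(P)$ such that every vertex of $P$ lies in some member of $\mathcal{C}$. For $\mathcal{C}\in\tilde{\mathcal{C}}_0(P)$, $\mathrm{ID}(P;\mathcal{C})$ denotes the identity $\prod_{F\in\mathcal{C}}([P]-[F])=0$ in $M(\mathcal{P}(W))$. Let $\tilde{\mathcal{A}}_0(P)\subseteq\tilde{\mathcal{C}}_0(P)$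 be the set of those $\mathcal{C}\in\tilde{\mathcal{C}}_0(P)$ that are minimal with respect to inclusion (these are necessarily antichains of faces). For $\mathcal{A},\mathcal{A}'\in\tilde{\mathcal{A}}_0(P)$, say $\mathcal{A}'$ covers $\mathcal{A}$ if there are a face $A\in\mathcal{A}$ and a set $\mathcal{B}\in\tilde{\mathcal{C}}_0(A)$ with $\mathcal{A}'=(\mathcal{A}\setminus\{A\})\cup\mathcal{B}$. The partial order $\preceq$ on $\tilde{\mathcal{A}}_0(P)$ is: $\mathcal{A}\preceq\mathcal{A}'$ if there is a finite sequence $\mathcal{A}=\mathcal{A}_0,\mathcal{A}_1,\dots,\mathcal{A}_k=\mathcal{A}'$ ($k\ge0$) such that each $\mathcal{A}_{i+1}$ covers $\mathcal{A}_i$. -}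

module Defs where

open import Algebra.Bundles using (CommutativeRing)
import Algebra.Properties.Group as GroupProperties
import Algebra.Properties.Ring as RingProperties
import Algebra.Properties.Semiring.Sum as SumProperties
open import Axiom.ExcludedMiddle using (ExcludedMiddle)
open import Data.Bool.Base using (if_then_else_)
open import Data.Fin.Base using (Fin; zero; suc)
open import Data.List.Base as List using (List; []; _∷_; _++_; foldr)
open import Data.List.Membership.Propositional using () renaming (_∈_ to _∈ˡ_)
open import Data.List.Membership.Propositional.Properties using (∈-cartesianProductWith⁺)
import Data.List.Membership.Setoid as SetoidMembership
import Data.List.Relation.Binary.Subset.Setoid as SetoidSubset
open import Data.List.Relation.Unary.All as All using (All; []; _∷_)
import Data.List.Relation.Unary.All.Properties as AllProperties
open import Data.List.Relation.Unary.Any using (Any; here; there)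
import Data.List.Relation.Unary.Unique.Setoid as SetoidUnique
open import Data.Nat.Base as ℕ using (ℕ; zero; suc)
open import Data.Product using (_×_; _,_; proj₁; proj₂; ∃; ∃-syntax)
open import Data.Sum.Base using (_⊎_; inj₁; inj₂)
open import Data.Vec.Functional as Vector using (Vector)
import Data.Vec.Functional.Relation.Binary.Equality.Setoid as VectorEquality
open import Function.Base using (_∘_)
open import Function.Bundles using (_⇔_; mk⇔; Equivalence)
open import Level using (Level; 0ℓ; _⊔_)
open import Relation.Binary.Bundles using (Poset; Setoid)
open import Relation.Binary.Construct.Closure.ReflexiveTransitive using (Star)
import Relation.Binary.Construct.On as On
open import Relation.Binary.Core using (Rel)
open import Relation.Binary.PropositionalEquality.Core using (refl)
import Relation.Binary.PropositionalEquality.Properties as ≡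
import Relation.Binary.Reasoning.PartialOrder as PosetReasoning
open import Relation.Binary.Structures using (IsTotalOrder)
open import Relation.Nullary using (¬_; does; yes; no; contradiction)
open import Relation.Unary using (Pred; _≐_; _∈_; Satisfiable)
open import Relation.Unary.Relation.Binary.Equality using (≐-setoid)

private
  variable
    a ℓ ℓ₁ ℓ₂ : Level
    A B : Set a
    m n : ℕ

-- A Dedekind-complete ordered field.  These axioms characterise ℝ up to
-- isomorphism, so a statement about an arbitrary such structure is a
-- statement about the real numbers.

record Reals : Set₁ where
  infix 4 _≤_
  field
    commutativeRing : CommutativeRing 0ℓ 0ℓ

  open CommutativeRing commutativeRing public

  field
    _≤_           : Rel Carrier 0ℓ
    isTotalOrder  : IsTotalOrder _≈_ _≤_
    +-monoʳ-≤     : ∀ x {y z} → y ≤ z → x + y ≤ x + z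
    *-nonNegative : ∀ {x y} → 0# ≤ x → 0# ≤ y → 0# ≤ x * y
    0≉1           : 0# ≉ 1#
    inverse       : ∀ x → x ≉ 0# → ∃[ y ] x * y ≈ 1#

  UpperBound : Pred Carrier 0ℓ → Pred Carrier 0ℓ
  UpperBound S b = ∀ x → x ∈ S → x ≤ b

  field
    supremum : ∀ S → Satisfiable S → Satisfiable (UpperBound S) →
               ∃[ s ] UpperBound S s × (∀ b → UpperBound S b → s ≤ b)

-- All the mathematics is classical; excluded middle is a parameter.

module LinearInequalities (em : ∀ {ℓ} → ExcludedMiddle ℓ) (ℝ : Reals) where

  open Reals ℝ hiding (zero) renaming (refl to ≈-refl)
  open SumProperties semiring public using (sum; sum-cong-≋; ∑-distrib-+; *-distribˡ-sum)
  open VectorEquality setoid public using (_≋_)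

  infix  4 _⊨_
  infixl 6 _+ᵥ_
  infixl 7 _·_

  _+ᵥ_ : Vector Carrier n → Vector Carrier n → Vector Carrier n
  _+ᵥ_ = Vector.zipWith _+_

  0ᵥ : Vector Carrier n
  0ᵥ = Vector.replicate _ 0#

  _·_ : Vector Carrier n → Vector Carrier n → Carrier
  u · x = sum (Vector.zipWith _*_ u x)

  record Halfspace (n : ℕ) : Set where
    constructor _≤ʰ_
    field
      normal : Vector Carrier n
      bound  : Carrier

  open Halfspace public

  _⊨_ : Vector Carrier n → Halfspace n → Set
  x ⊨ h = normal h · x ≤ bound h

  Solutions : List (Halfspace n) → Pred (Vector Carrier n) 0ℓ
  Solutions H x = All (x ⊨_) H

  IsPolyhedral : Pred (Vector Carrier n) 0ℓ → Set
  IsPolyhedral S = ∃[ H ] S ≐ Solutions H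

  MinkowskiSum : (S T : Pred (Vector Carrier n) 0ℓ) → Pred (Vector Carrier n) 0ℓ
  MinkowskiSum S T x = ∃[ y ] ∃[ z ] y ∈ S × z ∈ T × x ≋ y +ᵥ z

  -- Minkowski sums are projections of polyhedra, hence polyhedra.

  module FourierMotzkin where

    open Equivalence using (to; from)
    module ≤ = IsTotalOrder isTotalOrder

    poset : Poset 0ℓ 0ℓ 0ℓ
    poset = record { isPartialOrder = ≤.isPartialOrder }

    open GroupProperties +-group
    open RingProperties ring using (-‿distribˡ-*; -‿distribʳ-*; -1*x≈-x)
    open PosetReasoning poset

    +-monoˡ-≤ : ∀ x {y z} → y ≤ z → y + x ≤ z + x
    +-monoˡ-≤ x {y} {z} y≤z = begin
      y + x ≈⟨ +-comm y x ⟩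
      x + y ≤⟨ +-monoʳ-≤ x y≤z ⟩
      x + z ≈⟨ +-comm x z ⟩
      z + x ∎

    ≤-moveˡ : ∀ {x y z} → x ≤ y + z → x - z ≤ y
    ≤-moveˡ {x} {y} {z} x≤y+z = begin
      x - z     ≤⟨ +-monoˡ-≤ (- z) x≤y+z ⟩
      y + z - z ≈⟨ //-rightDividesʳ z y ⟩
      y         ∎

    ≤-moveˡ⁻ : ∀ {x y z} → x - z ≤ y → x ≤ y + z
    ≤-moveˡ⁻ {x} {y} {z} x-z≤y = begin
      x         ≈⟨ //-rightDividesˡ z x ⟨
      x - z + z ≤⟨ +-monoˡ-≤ z x-z≤y ⟩
      y + z     ∎

    ≤-moveʳ : ∀ {x y z} → x + z ≤ y → x ≤ y - z
    ≤-moveʳ {x} {y} {z} x+z≤y = begin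
      x         ≈⟨ //-rightDividesʳ z x ⟨
      x + z - z ≤⟨ +-monoˡ-≤ (- z) x+z≤y ⟩
      y - z     ∎

    ≤-moveʳ⁻ : ∀ {x y z} → x ≤ y - z → x + z ≤ y
    ≤-moveʳ⁻ {x} {y} {z} x≤y-z = begin
      x + z     ≤⟨ +-monoˡ-≤ z x≤y-z ⟩
      y - z + z ≈⟨ //-rightDividesˡ z y ⟩
      y         ∎

    telescope : ∀ x y z → (x - y) + (y - z) ≈ x - z
    telescope x y z = trans (sym (+-assoc (x - y) y (- z))) (+-congʳ (//-rightDividesˡ y x))

    ≤-exchange : ∀ {p q b c} → p - q ≤ b - c → c - q ≤ b - p
    ≤-exchange {p} {q} {b} {c} p-q≤b-c = begin
      c - q             ≈⟨ telescope c p q ⟨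
      (c - p) + (p - q) ≤⟨ +-monoʳ-≤ (c - p) p-q≤b-c ⟩
      (c - p) + (b - c) ≈⟨ +-comm (c - p) (b - c) ⟩
      (b - c) + (c - p) ≈⟨ telescope b c p ⟩
      b - p             ∎

    x≤y⇒0≤y-x : ∀ {x y} → x ≤ y → 0# ≤ y - x
    x≤y⇒0≤y-x {x} {y} x≤y = ≤-moveʳ (≤.trans (≤.reflexive (+-identityˡ x)) x≤y)

    neg-cancel-≤ : ∀ {x y} → - x ≤ - y → y ≤ x
    neg-cancel-≤ {x} {y} -x≤-y = begin
      y           ≈⟨ +-identityˡ y ⟨
      0# + y      ≈⟨ +-congʳ (-‿inverseʳ x) ⟨
      x - x + y   ≤⟨ ≤-moveʳ⁻ (+-monoʳ-≤ x -x≤-y) ⟩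
      x           ∎

    x≤0⇒0≤-x : ∀ {x} → x ≤ 0# → 0# ≤ - x
    x≤0⇒0≤-x {x} x≤0 = ≤.trans (x≤y⇒0≤y-x x≤0) (≤.reflexive (+-identityˡ (- x)))

    *-monoʳ-≤-nonNeg : ∀ {c x y} → 0# ≤ c → x ≤ y → c * x ≤ c * y
    *-monoʳ-≤-nonNeg {c} {x} {y} 0≤c x≤y = begin
      c * x                     ≈⟨ +-identityˡ (c * x) ⟨
      0# + c * x                ≤⟨ +-monoˡ-≤ (c * x) (*-nonNegative 0≤c (x≤y⇒0≤y-x x≤y)) ⟩
      c * (y - x) + c * x       ≈⟨ distribˡ c (y - x) x ⟨
      c * (y - x + x)           ≈⟨ *-congˡ (//-rightDividesˡ x y) ⟩
      c * y                     ∎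

    *-monoʳ-≤-nonPos : ∀ {c x y} → c ≤ 0# → x ≤ y → c * y ≤ c * x
    *-monoʳ-≤-nonPos {c} {x} {y} c≤0 x≤y = neg-cancel-≤ (begin
      - (c * x) ≈⟨ -‿distribˡ-* c x ⟩
      - c * x   ≤⟨ *-monoʳ-≤-nonNeg (x≤0⇒0≤-x c≤0) x≤y ⟩
      - c * y   ≈⟨ -‿distribˡ-* c y ⟨
      - (c * y) ∎)

    1≰0 : ¬ 1# ≤ 0#
    1≰0 1≤0 = 0≉1 (≤.antisym 0≤1 1≤0)
      where
      0≤1 : 0# ≤ 1#
      0≤1 = begin
        0#          ≤⟨ *-nonNegative (x≤0⇒0≤-x 1≤0) (x≤0⇒0≤-x 1≤0) ⟩
        - 1# * - 1# ≈⟨ -1*x≈-x (- 1#) ⟩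
        - (- 1#)    ≈⟨ ⁻¹-involutive 1# ⟩
        1#          ∎

    inverse-nonNeg : ∀ {c r} → c * r ≈ 1# → 0# ≤ c → 0# ≤ r
    inverse-nonNeg {c} {r} cr≈1 0≤c with ≤.total 0# r
    ... | inj₁ 0≤r = 0≤r
    ... | inj₂ r≤0 = contradiction (begin
      1#     ≈⟨ cr≈1 ⟨
      c * r  ≤⟨ *-monoʳ-≤-nonNeg 0≤c r≤0 ⟩
      c * 0# ≈⟨ zeroʳ c ⟩
      0#     ∎) 1≰0

    inverse-nonPos : ∀ {c r} → c * r ≈ 1# → c ≤ 0# → r ≤ 0#
    inverse-nonPos {c} {r} cr≈1 c≤0 with ≤.total 0# r
    ... | inj₂ r≤0 = r≤0
    ... | inj₁ 0≤r = contradiction (begin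
      1#     ≈⟨ cr≈1 ⟨
      c * r  ≤⟨ *-monoʳ-≤-nonPos c≤0 0≤r ⟩
      c * 0# ≈⟨ zeroʳ c ⟩
      0#     ∎) 1≰0

    ·-congʳ : ∀ (u : Vector Carrier n) {x y} → x ≋ y → u · x ≈ u · y
    ·-congʳ u x≋y = sum-cong-≋ (λ i → *-congˡ (x≋y i))

    ·-zeroˡ : ∀ (x : Vector Carrier n) → 0ᵥ · x ≈ 0#
    ·-zeroˡ {zero}  x = ≈-refl
    ·-zeroˡ {suc n} x = trans (+-cong (zeroˡ _) (·-zeroˡ (Vector.tail x))) (+-identityˡ 0#)

    ·-scaleˡ : ∀ c (u x : Vector Carrier n) → Vector.map (c *_) u · x ≈ c * (u · x)
    ·-scaleˡ c u x = trans (sum-cong-≋ (λ i → *-assoc c (u i) (x i)))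
                           (sym (*-distribˡ-sum c (Vector.zipWith _*_ u x)))

    ·-distribʳ : ∀ (u v x : Vector Carrier n) → (u +ᵥ v) · x ≈ u · x + v · x
    ·-distribʳ u v x = trans (sum-cong-≋ (λ i → distribʳ (x i) (u i) (v i)))
                             (∑-distrib-+ (Vector.zipWith _*_ u x) (Vector.zipWith _*_ v x))

    ·-negˡ : ∀ (u x : Vector Carrier n) → Vector.map -_ u · x ≈ - (u · x)
    ·-negˡ u x = trans (sum-cong-≋ (λ i → *-congʳ (sym (-1*x≈-x (u i)))))
                       (trans (·-scaleˡ (- 1#) u x) (-1*x≈-x (u · x)))

    ·-distribˡ : ∀ (u x y : Vector Carrier n) → u · (x +ᵥ y) ≈ u · x + u · y
    ·-distribˡ u x y = trans (sum-cong-≋ (λ i → distribˡ (u i) (x i) (y i)))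
                             (∑-distrib-+ (Vector.zipWith _*_ u x) (Vector.zipWith _*_ u y))

    -- A halfspace in x read as a bound on an extra coordinate t.

    Lower Upper : Vector Carrier n → Carrier → Halfspace n → Set
    Lower x t l = bound l ≤ t + normal l · x
    Upper x t u = t + normal u · x ≤ bound u

    module _ (h : Halfspace (suc n)) where
      α b : Carrier
      α = normal h zero
      b = bound h

      scaled : Carrier → Halfspace n
      scaled r = Vector.map (r *_) (Vector.tail (normal h)) ≤ʰ (r * b)

      module _ {r : Carrier} (αr≈1 : α * r ≈ 1#) (x : Vector Carrier n) (t : Carrier) where
        p : Carrier
        p = Vector.tail (normal h) · x

        scale : r * (α * t + p) ≈ t + normal (scaled r) · x
        scale = trans (distribˡ r (α * t) p) (+-cong
          (trans (sym (*-assoc r α t)) (trans (*-congʳ (trans (*-comm r α) αr≈1)) (*-identityˡ t)))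
          (sym (·-scaleˡ r (Vector.tail (normal h)) x)))

        unscale : ∀ y → α * (r * y) ≈ y
        unscale y = trans (sym (*-assoc α r y)) (trans (*-congʳ αr≈1) (*-identityˡ y))

        upper : 0# ≤ α → ((t Vector.∷ x) ⊨ h) ⇔ Upper x t (scaled r)
        upper 0≤α = mk⇔
          (λ s → ≤.trans (≤.reflexive (sym scale)) (*-monoʳ-≤-nonNeg (inverse-nonNeg αr≈1 0≤α) s))
          (λ s → begin
            α * t + p             ≈⟨ unscale (α * t + p) ⟨
            α * (r * (α * t + p)) ≤⟨ *-monoʳ-≤-nonNeg 0≤α (≤.trans (≤.reflexive scale) s) ⟩
            α * (r * b)           ≈⟨ unscale b ⟩
            b                     ∎)

        lower : α ≤ 0# → ((t Vector.∷ x) ⊨ h) ⇔ Lower x t (scaled r)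
        lower α≤0 = mk⇔
          (λ s → ≤.trans (*-monoʳ-≤-nonPos (inverse-nonPos αr≈1 α≤0) s) (≤.reflexive scale))
          (λ s → begin
            α * t + p             ≈⟨ unscale (α * t + p) ⟨
            α * (r * (α * t + p)) ≤⟨ *-monoʳ-≤-nonPos α≤0 (≤.trans s (≤.reflexive (sym scale))) ⟩
            α * (r * b)           ≈⟨ unscale b ⟩
            b                     ∎)

      free : α ≈ 0# → ∀ x t →
             ((t Vector.∷ x) ⊨ h) ⇔ (x ⊨ (Vector.tail (normal h) ≤ʰ b))
      free α≈0 x t = mk⇔ (≤.trans (≤.reflexive (sym drop))) (≤.trans (≤.reflexive drop))
        where
        drop : α * t + Vector.tail (normal h) · x ≈ Vector.tail (normal h) · x
        drop = trans (+-congʳ (trans (*-congʳ α≈0) (zeroˡ t))) (+-identityˡ _)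

    record Split (H : List (Halfspace (suc n))) : Set where
      field
        lowers uppers frees : List (Halfspace n)
        split : ∀ x t → (t Vector.∷ x) ∈ Solutions H ⇔
                (All (Lower x t) lowers × All (Upper x t) uppers × x ∈ Solutions frees)

    splitting : (H : List (Halfspace (suc n))) → Split H
    splitting [] = record
      { lowers = [] ; uppers = [] ; frees = []
      ; split = λ x t → mk⇔ (λ _ → [] , [] , []) (λ _ → []) }
    splitting (h ∷ H) with splitting H | em {P = α h ≈ 0#} | ≤.total 0# (α h)
    ... | S | yes α≈0 | _ = record
      { lowers = lowers ; uppers = uppers ; frees = (Vector.tail (normal h) ≤ʰ bound h) ∷ frees
      ; split = λ x t → mk⇔
          (λ { (s ∷ ss) → let (l , u , f) = to (split x t) ss in l , u , to (free h α≈0 x t) s ∷ f })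
          (λ { (l , u , s ∷ f) → from (free h α≈0 x t) s ∷ from (split x t) (l , u , f) }) }
      where open Split S
    ... | S | no α≉0 | inj₁ 0≤α = let (r , αr≈1) = inverse (α h) α≉0 in record
      { lowers = lowers ; uppers = scaled h r ∷ uppers ; frees = frees
      ; split = λ x t → mk⇔
          (λ { (s ∷ ss) → let (l , u , f) = to (split x t) ss in
                          l , to (upper h αr≈1 x t 0≤α) s ∷ u , f })
          (λ { (l , s ∷ u , f) → from (upper h αr≈1 x t 0≤α) s ∷ from (split x t) (l , u , f) }) }
      where open Split S
    ... | S | no α≉0 | inj₂ α≤0 = let (r , αr≈1) = inverse (α h) α≉0 in record
      { lowers = scaled h r ∷ lowers ; uppers = uppers ; frees = frees
      ; split = λ x t → mk⇔
          (λ { (s ∷ ss) → let (l , u , f) = to (split x t) ss in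
                          to (lower h αr≈1 x t α≤0) s ∷ l , u , f })
          (λ { (s ∷ l , u , f) → from (lower h αr≈1 x t α≤0) s ∷ from (split x t) (l , u , f) }) }
      where open Split S

    between : (f : A → Carrier) (g : B → Carrier) (xs : List A) (ys : List B) →
              (∀ {x y} → x ∈ˡ xs → y ∈ˡ ys → f x ≤ g y) →
              ∃[ t ] (∀ {x} → x ∈ˡ xs → f x ≤ t) × (∀ {y} → y ∈ˡ ys → t ≤ g y)
    between f g [] [] _ = 0# , (λ ()) , (λ ())
    between f g [] (y ∷ ys) _ with between f g [] ys (λ ())
    ... | t , _ , t≤ with ≤.total t (g y)
    ...   | inj₁ t≤gy = t , (λ ()) , λ { (here refl) → t≤gy ; (there y∈) → t≤ y∈ }
    ...   | inj₂ gy≤t = g y , (λ ()) , λ { (here refl) → ≤.refl ; (there y∈) → ≤.trans gy≤t (t≤ y∈) }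
    between f g (x ∷ xs) ys f≤g with between f g xs ys (f≤g ∘ there)
    ... | t , ≤t , t≤ with ≤.total t (f x)
    ...   | inj₁ t≤fx = f x , (λ { (here refl) → ≤.refl ; (there x∈) → ≤.trans (≤t x∈) t≤fx })
                            , f≤g (here refl)
    ...   | inj₂ fx≤t = t , (λ { (here refl) → fx≤t ; (there x∈) → ≤t x∈ }) , t≤

    combine : Halfspace n → Halfspace n → Halfspace n
    combine l u = (normal u +ᵥ Vector.map -_ (normal l)) ≤ʰ (bound u - bound l)

    combine-⊨ : ∀ (l u : Halfspace n) x →
                (x ⊨ combine l u) ⇔ (bound l - normal l · x ≤ bound u - normal u · x)
    combine-⊨ l u x = mk⇔
      (λ s → ≤-exchange (≤.trans (≤.reflexive (sym lhs)) s))
      (λ s → ≤.trans (≤.reflexive lhs) (≤-exchange s))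
      where
      lhs : normal (combine l u) · x ≈ normal u · x - normal l · x
      lhs = trans (·-distribʳ (normal u) _ x) (+-congˡ (·-negˡ (normal l) x))

    eliminate : {S : Pred (Vector Carrier (suc n)) 0ℓ} → IsPolyhedral S →
                IsPolyhedral (λ x → ∃[ t ] (t Vector.∷ x) ∈ S)
    eliminate {S = S} (H , S⊆ , ⊆S) =
      pairs ++ frees , forth , back
      where
      open Split (splitting H)
      pairs = List.cartesianProductWith combine lowers uppers

      forth : ∀ {x} → ∃[ t ] (t Vector.∷ x) ∈ S → x ∈ Solutions (pairs ++ frees)
      forth {x} (t , s) =
        let (l , u , f) = to (split x t) (S⊆ s) in
        AllProperties.++⁺
          (AllProperties.cartesianProductWith⁺ (≡.setoid _) (≡.setoid _) combine lowers uppers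
            (λ {y} {z} y∈ z∈ → from (combine-⊨ y z x)
              (≤.trans (≤-moveˡ (All.lookup l y∈)) (≤-moveʳ (All.lookup u z∈)))))
          f

      back : ∀ {x} → x ∈ Solutions (pairs ++ frees) → ∃[ t ] (t Vector.∷ x) ∈ S
      back {x} s =
        let (c , f) = AllProperties.++⁻ pairs s
            (t , l , u) = between (λ y → bound y - normal y · x) (λ z → bound z - normal z · x)
              lowers uppers (λ {y} {z} y∈ z∈ →
                to (combine-⊨ y z x) (All.lookup c (∈-cartesianProductWith⁺ combine y∈ z∈)))
        in t , ⊆S (from (split x t)
             (All.tabulate (≤-moveˡ⁻ ∘ l) , All.tabulate (≤-moveʳ⁻ ∘ u) , f))

    infixr 5 _⧺_
    _⧺_ : Vector Carrier m → Vector Carrier n → Vector Carrier (m ℕ.+ n)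
    _⧺_ {zero}  y x = x
    _⧺_ {suc m} y x = Vector.head y Vector.∷ (Vector.tail y ⧺ x)

    ·-⧺ : ∀ (u y : Vector Carrier m) (v x : Vector Carrier n) →
          (u ⧺ v) · (y ⧺ x) ≈ u · y + v · x
    ·-⧺ {zero}  u y v x = sym (+-identityˡ _)
    ·-⧺ {suc m} u y v x =
      trans (+-congˡ (·-⧺ (Vector.tail u) (Vector.tail y) v x)) (sym (+-assoc _ _ _))

    IsPolyhedral-resp-≐ : {S T : Pred (Vector Carrier n) 0ℓ} → S ≐ T →
                          IsPolyhedral S → IsPolyhedral T
    IsPolyhedral-resp-≐ (S⊆T , T⊆S) (H , S⊆ , ⊆S) = H , S⊆ ∘ T⊆S , S⊆T ∘ ⊆S

    project : ∀ m {S : Pred (Vector Carrier (m ℕ.+ n)) 0ℓ} → IsPolyhedral S →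
              IsPolyhedral (λ x → ∃ λ (y : Vector Carrier m) → (y ⧺ x) ∈ S)
    project zero    pS = IsPolyhedral-resp-≐ ((λ s → Vector.[] , s) , proj₂) pS
    project (suc m) pS = IsPolyhedral-resp-≐
      ( (λ { (y , t , s) → t Vector.∷ y , s })
      , (λ { (y , s) → Vector.tail y , Vector.head y , s }) )
      (project m (eliminate pS))

    module _ {n : ℕ} where

      onFirst onDifference : Halfspace n → Halfspace (n ℕ.+ n)
      onFirst      h = (normal h ⧺ 0ᵥ) ≤ʰ bound h
      onDifference h = (Vector.map -_ (normal h) ⧺ normal h) ≤ʰ bound h

      onFirst-· : ∀ h y x → normal (onFirst h) · (y ⧺ x) ≈ normal h · y
      onFirst-· h y x =
        trans (·-⧺ (normal h) y 0ᵥ x) (trans (+-congˡ (·-zeroˡ x)) (+-identityʳ _))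

      onDifference-· : ∀ h y x →
        normal (onDifference h) · (y ⧺ x) ≈ normal h · (x +ᵥ Vector.map -_ y)
      onDifference-· h y x = trans (·-⧺ _ y (normal h) x) (trans (+-comm _ _)
        (trans (+-congˡ (sum-cong-≋ λ i →
                  trans (sym (-‿distribˡ-* (normal h i) (y i))) (-‿distribʳ-* (normal h i) (y i))))
               (sym (·-distribˡ (normal h) x (Vector.map -_ y)))))

    minkowskiSum-isPolyhedral : {S T : Pred (Vector Carrier n) 0ℓ} →
      IsPolyhedral S → IsPolyhedral T → IsPolyhedral (MinkowskiSum S T)
    minkowskiSum-isPolyhedral {n} {S} {T} (H , S⊆ , ⊆S) (K , T⊆ , ⊆T) =
      IsPolyhedral-resp-≐ (forth , back) (project n (H′ ++ K′ , (λ s → s) , (λ s → s)))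
      where
      H′ = List.map onFirst H
      K′ = List.map onDifference K

      forth : ∀ {x} → ∃ (λ (y : Vector Carrier n) → (y ⧺ x) ∈ Solutions (H′ ++ K′)) → x ∈ MinkowskiSum S T
      forth {x} (y , s) =
        y , x +ᵥ Vector.map -_ y
        , ⊆S (All.map (λ {h} → ≤.trans (≤.reflexive (sym (onFirst-· h y x))))
                (AllProperties.map⁻ (proj₁ (AllProperties.++⁻ H′ s))))
        , ⊆T (All.map (λ {h} → ≤.trans (≤.reflexive (sym (onDifference-· h y x))))
                (AllProperties.map⁻ (proj₂ (AllProperties.++⁻ H′ s))))
        , λ i → trans (sym (//-rightDividesˡ (y i) (x i))) (+-comm _ _)

      back : ∀ {x} → x ∈ MinkowskiSum S T → ∃ λ (y : Vector Carrier n) → (y ⧺ x) ∈ Solutions (H′ ++ K′)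
      back {x} (y , z , y∈S , z∈T , x≋y+z) =
        y , AllProperties.++⁺
          (AllProperties.map⁺ (All.map (λ {h} → ≤.trans (≤.reflexive (onFirst-· h y x))) (S⊆ y∈S)))
          (AllProperties.map⁺ (All.map
            (λ {h} → ≤.trans (≤.reflexive
              (trans (onDifference-· h y x) (·-congʳ (normal h) x-y≋z)))) (T⊆ z∈T)))
        where
        x-y≋z : (x +ᵥ Vector.map -_ y) ≋ z
        x-y≋z i = trans (+-congʳ (trans (x≋y+z i) (+-comm _ _))) (//-rightDividesʳ (y i) (z i))

    origin-isPolyhedral : IsPolyhedral {n} (_≋ 0ᵥ)
    origin-isPolyhedral {zero}  = [] , (λ _ → []) , (λ _ ())
    origin-isPolyhedral {suc n} =
      let (H , ⊆H , H⊆) = origin-isPolyhedral {n} in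
      (1# ⊲ 0ᵥ) ≤ʰ 0# ∷ (- 1# ⊲ 0ᵥ) ≤ʰ 0# ∷ List.map lift H
      , (λ {x} x≋0 →
          ≤.reflexive (trans (first 1# x) (trans (*-identityˡ _) (x≋0 zero)))
          ∷ ≤.reflexive (trans (first (- 1#) x) (trans (*-congˡ (x≋0 zero)) (zeroʳ _)))
          ∷ AllProperties.map⁺ (All.map (λ {h} → ≤.trans (≤.reflexive (rest h x)))
              (⊆H (x≋0 ∘ suc))))
      , λ { {x} (x₀≤0 ∷ -x₀≤0 ∷ s) → λ where
          zero    → ≤.antisym
            (≤.trans (≤.reflexive (sym (trans (first 1# x) (*-identityˡ _)))) x₀≤0)
            (neg-cancel-≤ (≤.trans (≤.reflexive (sym (trans (first (- 1#) x) (-1*x≈-x _))))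
                                   (≤.trans -x₀≤0 (≤.reflexive (sym ε⁻¹≈ε)))))
          (suc i) → H⊆ (All.map (λ {h} → ≤.trans (≤.reflexive (sym (rest h x))))
                          (AllProperties.map⁻ s)) i }
      where
      infixr 6 _⊲_
      _⊲_ : Carrier → Vector Carrier n → Vector Carrier (suc n)
      _⊲_ = Vector._∷_

      lift : Halfspace n → Halfspace (suc n)
      lift h = (0# ⊲ normal h) ≤ʰ bound h

      first : ∀ c x → (c ⊲ 0ᵥ) · x ≈ c * x zero
      first c x = trans (+-congˡ (·-zeroˡ (Vector.tail x))) (+-identityʳ _)

      rest : ∀ h x → normal (lift h) · x ≈ normal h · Vector.tail x
      rest h x = trans (+-congʳ (zeroˡ (x zero))) (+-identityˡ _)

  open FourierMotzkin public using (minkowskiSum-isPolyhedral; origin-isPolyhedral)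

Minimal : {A : Set a} → Rel A ℓ₁ → Rel A ℓ₂ → Pred A ℓ → Pred A (a ⊔ ℓ₁ ⊔ ℓ₂ ⊔ ℓ)
Minimal _≈_ _≤_ S x = x ∈ S × (∀ y → y ∈ S → y ≤ x → y ≈ x)

module Polytopes (em : ∀ {ℓ} → ExcludedMiddle ℓ) (ℝ : Reals) (d : ℕ) where

  open Reals ℝ using (Carrier; _≈_; _≤_; _+_; _*_; -_; _-_; 0#; 1#)
  open LinearInequalities em ℝ

  W : Set
  W = Vector Carrier d

  record Polyhedron : Set₁ where
    constructor polyhedron
    field
      points       : Pred W 0ℓ
      isPolyhedral : IsPolyhedral points

  open Polyhedron public

  polyhedronSetoid : Setoid _ _
  polyhedronSetoid = On.setoid (≐-setoid W 0ℓ) points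

  open Setoid polyhedronSetoid public using () renaming (_≈_ to _≐ₚ_)

  infixl 6 _⊕_
  _⊕_ : Polyhedron → Polyhedron → Polyhedron
  A ⊕ B = polyhedron (MinkowskiSum (points A) (points B))
                     (minkowskiSum-isPolyhedral (isPolyhedral A) (isPolyhedral B))

  ｛0｝ : Polyhedron
  ｛0｝ = polyhedron (_≋ 0ᵥ) origin-isPolyhedral

  infix 4 _≈ℂ_
  infixl 6 _+ℂ_
  infixl 7 _*ℂ_

  record ℂ : Set where
    constructor _+i_
    field
      re im : Carrier

  open ℂ public

  _≈ℂ_ : Rel ℂ 0ℓ
  z ≈ℂ w = re z ≈ re w × im z ≈ im w

  0ℂ 1ℂ : ℂ
  0ℂ = 0# +i 0#
  1ℂ = 1# +i 0#

  -ℂ_ : ℂ → ℂ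
  -ℂ z = (- re z) +i (- im z)

  _+ℂ_ _*ℂ_ : ℂ → ℂ → ℂ
  z +ℂ w = (re z + re w) +i (im z + im w)
  z *ℂ w = (re z * re w - im z * im w) +i (re z * im w + im z * re w)

  indicator : Pred W 0ℓ → W → ℂ
  indicator S w = if does (em {P = w ∈ S}) then 1ℂ else 0ℂ

  -- An element of M(𝒫(W)) is presented by a formal linear combination of
  -- polyhedra.  It stands for the function ⟦ f ⟧, and two presentations are
  -- equal when their functions are.  The product extends [A] · [B] = [A + B]
  -- bilinearly; a summand with A or B empty is harmless, since then A + B is
  -- empty and [A + B] = 0.

  M : Set₁
  M = List (ℂ × Polyhedron)

  ⟦_⟧ : M → W → ℂ
  ⟦ f ⟧ w = foldr (λ (c , A) z → c *ℂ indicator (points A) w +ℂ z) 0ℂ f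

  infix 4 _≈ᴹ_
  infixl 6 _-ᴹ_
  infixl 7 _·ᴹ_

  _≈ᴹ_ : Rel M 0ℓ
  f ≈ᴹ g = ∀ w → ⟦ f ⟧ w ≈ℂ ⟦ g ⟧ w

  [_]ᴹ : Polyhedron → M
  [ A ]ᴹ = List.[ 1ℂ , A ]

  0ᴹ 1ᴹ : M
  0ᴹ = []
  1ᴹ = [ ｛0｝ ]ᴹ

  _-ᴹ_ _·ᴹ_ : M → M → M
  f -ᴹ g = f ++ List.map (λ (c , A) → -ℂ c , A) g
  f ·ᴹ g = List.cartesianProductWith (λ (b , A) (c , B) → b *ℂ c , A ⊕ B) f g

  ∏ : List M → M
  ∏ = foldr _·ᴹ_ 1ᴹ

  combination : Vector Carrier n → Vector W n → W
  combination μ p j = sum (λ i → μ i * p i j)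

  convexHull : Vector W n → Pred W 0ℓ
  convexHull p x = ∃[ μ ] (∀ i → 0# ≤ μ i) × sum μ ≈ 1# × x ≋ combination μ p

  affineHull : Vector W n → Pred W 0ℓ
  affineHull p x = ∃[ μ ] sum μ ≈ 1# × x ≋ combination μ p

  AffinelyIndependent : Vector W n → Set
  AffinelyIndependent p =
    ∀ μ → sum μ ≈ 0# → combination μ p ≋ 0ᵥ → ∀ i → μ i ≈ 0#

  IsPolytope : Polyhedron → Set
  IsPolytope P = ∃[ n ] ∃ λ (p : Vector W n) → points P ≐ convexHull p

  HasDimension : ℕ → Pred W 0ℓ → Set
  HasDimension k S = ∃ λ (p : Vector W (suc k)) →
    AffinelyIndependent p × (∀ i → p i ∈ S) × (∀ x → x ∈ S → x ∈ affineHull p)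

  -- The case u = 0 makes P a face of itself.

  IsFace : (F P : Pred W 0ℓ) → Set
  IsFace F P = ∃[ u ] F ≐ (λ x → x ∈ P × (∀ y → y ∈ P → u · y ≤ u · x))

  IsVertex : W → Pred W 0ℓ → Set
  IsVertex v P = IsFace (_≋ v) P

  ℱ : Polyhedron → Pred Polyhedron 0ℓ
  ℱ P F = IsFace (points F) (points P) × Satisfiable (points F) × ¬ F ≐ₚ P

  -- A finite set of polyhedra is a list without repetitions; polyhedra and
  -- sets of polyhedra are compared extensionally.

  open SetoidMembership polyhedronSetoid public using () renaming (_∈_ to _∈ₛ_)
  open SetoidSubset polyhedronSetoid public using () renaming (_⊆_ to _⊆ₛ_)
  open SetoidUnique polyhedronSetoid public using (Unique)

  infix 4 _≈ₛ_
  _≈ₛ_ : Rel (List Polyhedron) _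
  𝒞 ≈ₛ 𝒟 = 𝒞 ⊆ₛ 𝒟 × 𝒟 ⊆ₛ 𝒞

  C̃₀ : Polyhedron → Pred (List Polyhedron) _
  C̃₀ P 𝒞 = Unique 𝒞 × All (ℱ P) 𝒞 ×
            (∀ v → IsVertex v (points P) → Any (λ F → v ∈ points F) 𝒞)

  ID : Polyhedron → List Polyhedron → Set
  ID P 𝒞 = ∏ (List.map (λ F → [ P ]ᴹ -ᴹ [ F ]ᴹ) 𝒞) ≈ᴹ 0ᴹ

  Ã₀ : Polyhedron → Pred (List Polyhedron) _
  Ã₀ P = Minimal _≈ₛ_ _⊆ₛ_ (C̃₀ P)

  Covers : Polyhedron → Rel (List Polyhedron) _
  Covers P 𝒜 𝒜′ = 𝒜 ∈ Ã₀ P × 𝒜′ ∈ Ã₀ P ×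
    (∃[ A ] ∃[ ℬ ] A ∈ₛ 𝒜 × ℬ ∈ C̃₀ A ×
      (∀ F → F ∈ₛ 𝒜′ ⇔ ((F ∈ₛ 𝒜 × ¬ F ≐ₚ A) ⊎ F ∈ₛ ℬ)))

  -- Covers is invariant under _≈ₛ_, so this is its reflexive-transitive
  -- closure on sets, as opposed to lists, of polyhedra.

  Precedes : Polyhedron → Rel (List Polyhedron) _
  Precedes P 𝒜 𝒜′ = ∃[ 𝒵 ] Star (Covers P) 𝒜 𝒵 × 𝒵 ≈ₛ 𝒜′

{-# OPTIONS --safe #-}

-- A generating element is evaluated through the support functions h of its
-- polytopes: A ↦ e^{h_A(u)} is multiplicative in A for every direction u.
-- Some F ∈ 𝒞 contains a vertex of P maximising u, and then h_F(u) = h_P(u), so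
-- the factor [P] - [F] and with it the whole product is sent to zero.
--
-- Conversely, support functions determine values at points.  The directions
-- strictly separating A from w form an open convex cone, empty iff w ∈ A, so it
-- remains to see that a linear relation between indicators of open convex sets
-- persists when each indicator is replaced by 1 if the set is nonempty and by 0
-- otherwise.  This is an Euler characteristic, obtained by integrating one
-- coordinate at a time.

module Submission where

open import Defs
open import Axiom.ExcludedMiddle using (ExcludedMiddle)
open import Data.Nat.Base using (ℕ; zero; suc)
open import Relation.Unary using (_∈_)

import Algebra.Properties.CommutativeSemigroup as CommutativeSemigroupProperties
import Algebra.Properties.Group as GroupProperties
import Algebra.Properties.Ring as RingProperties
import Algebra.Properties.Semiring.Sum as SemiringSum
open import Data.Bool.Base using (if_then_else_)
open import Data.Fin.Base using (Fin; zero; suc)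
open import Data.List.Base as List using (List; []; _∷_; _++_)
import Data.List.Extrema as Extrema
open import Data.List.Membership.Propositional using (find; lose) renaming (_∈_ to _∈ˡ_)
open import Data.List.Membership.Propositional.Properties
  using (∈-filter⁺; ∈-allFin; ∈-cartesianProductWith⁺)
open import Data.List.Properties using (map-++; ++-identityʳ)
open import Data.List.Relation.Unary.All as All using (All; []; _∷_)
import Data.List.Relation.Unary.All.Properties as AllP
open import Data.List.Relation.Unary.Any as Any using (Any; here; there)
import Data.List.Relation.Unary.Any.Properties as AnyP
open import Data.Product using (_×_; _,_; proj₁; proj₂; ∃-syntax; map₁; map₂)
open import Data.Sum.Base using (inj₁; inj₂)
open import Data.Unit.Base using (⊤)
open import Data.Vec.Functional as Vector using (Vector)
open import Function.Base using (_∘_; id)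
open import Function.Bundles using (_⇔_; mk⇔; Equivalence)
open import Level using (Level; 0ℓ)
open import Relation.Binary.Bundles using (TotalOrder)
open import Relation.Binary.Core using (Rel)
open import Relation.Binary.Definitions using (Symmetric; Transitive)
import Relation.Binary.Properties.TotalOrder as TotalOrderProperties
import Relation.Binary.PropositionalEquality.Core as ≡
import Relation.Binary.PropositionalEquality.Properties as ≡P
import Relation.Binary.Reasoning.PartialOrder as PosetReasoning
import Relation.Binary.Reasoning.Setoid as SetoidReasoning
open import Relation.Nullary using (¬_; does; yes; no; contradiction)
open import Relation.Unary using (Pred; Satisfiable; _∩_; ∁; _⊆_; _≐_)

private
  variable
    a ℓ ℓ₁ ℓ₂ : Level
    X Y : Set a
    n : ℕ

-- Ordered-field arithmetic and strict inequalities under small perturbations.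

module OrderedField (em : ∀ {ℓ} → ExcludedMiddle ℓ) (ℝ : Reals) where

  open Reals ℝ hiding (zero) renaming (refl to ≈-refl)
  open LinearInequalities em ℝ
  open FourierMotzkin public using
    ( module ≤; poset; +-monoˡ-≤; *-monoʳ-≤-nonNeg; 1≰0; inverse-nonNeg; x≤y⇒0≤y-x
    ; ≤-moveˡ; ≤-moveˡ⁻; ≤-moveʳ )
  open GroupProperties +-group using (//-rightDividesˡ; //-rightDividesʳ)
  open PosetReasoning poset
  open CommutativeSemigroupProperties +-commutativeSemigroup
    using () renaming (x∙yz≈y∙xz to x+[y+z]≈y+[x+z])
  open CommutativeSemigroupProperties *-commutativeSemigroup
    using () renaming (x∙yz≈y∙xz to x*[y*z]≈y*[x*z]; xy∙z≈zy∙x to [x*y]*z≈[z*y]*x)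

  ≤-totalOrder : TotalOrder 0ℓ 0ℓ 0ℓ
  ≤-totalOrder = record { isTotalOrder = isTotalOrder }

  open TotalOrderProperties ≤-totalOrder public using (_<_; <⇒≱; ≰⇒>; ≰⇒≥)

  <⇒≤ : ∀ {x y} → x < y → x ≤ y
  <⇒≤ = proj₁

  ≮⇒≥ : ∀ {x y} → ¬ x < y → y ≤ x
  ≮⇒≥ {x} {y} x≮y with em {P = y ≤ x}
  ... | yes y≤x = y≤x
  ... | no y≰x = contradiction (≰⇒> y≰x) x≮y

  +-cancelʳ-≤ : ∀ z {x y} → x + z ≤ y + z → x ≤ y
  +-cancelʳ-≤ z {x} {y} x+z≤y+z = begin
    x         ≤⟨ ≤-moveʳ x+z≤y+z ⟩
    y + z - z ≈⟨ //-rightDividesʳ z y ⟩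
    y         ∎

  +-cancelˡ-≤ : ∀ z {x y} → z + x ≤ z + y → x ≤ y
  +-cancelˡ-≤ z {x} {y} z+x≤z+y = +-cancelʳ-≤ z (begin
    x + z ≈⟨ +-comm x z ⟩
    z + x ≤⟨ z+x≤z+y ⟩
    z + y ≈⟨ +-comm z y ⟩
    y + z ∎)

  +-mono-≤ : ∀ {x y u v} → x ≤ y → u ≤ v → x + u ≤ y + v
  +-mono-≤ {x} {y} {u} {v} x≤y u≤v = ≤.trans (+-monoʳ-≤ x u≤v) (+-monoˡ-≤ v x≤y)

  +-monoˡ-< : ∀ z {x y} → x < y → x + z < y + z
  +-monoˡ-< z x<y = ≰⇒> (λ y+z≤x+z → <⇒≱ x<y (+-cancelʳ-≤ z y+z≤x+z))

  +-monoʳ-< : ∀ z {x y} → x < y → z + x < z + y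
  +-monoʳ-< z x<y = ≰⇒> (λ z+y≤z+x → <⇒≱ x<y (+-cancelˡ-≤ z z+y≤z+x))

  x<x+y : ∀ {x y} → 0# < y → x < x + y
  x<x+y {x} {y} 0<y = begin-strict
    x      ≈⟨ +-identityʳ x ⟨
    x + 0# <⟨ +-monoʳ-< x 0<y ⟩
    x + y  ∎

  0<1 : 0# < 1#
  0<1 = ≰⇒> 1≰0

  inverse-positive : ∀ {c r} → c * r ≈ 1# → 0# < c → 0# < r
  inverse-positive {c} {r} cr≈1 (0≤c , _) = inverse-nonNeg cr≈1 0≤c , λ 0≈r → 0≉1 (begin-equality
    0#     ≈⟨ zeroʳ c ⟨
    c * 0# ≈⟨ *-congˡ 0≈r ⟩
    c * r  ≈⟨ cr≈1 ⟩
    1#     ∎)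

  *-cancelˡ-≤-pos : ∀ {c x y} → 0# < c → c * x ≤ c * y → x ≤ y
  *-cancelˡ-≤-pos {c} {x} {y} 0<c cx≤cy with inverse c (proj₂ 0<c ∘ sym)
  ... | r , cr≈1 = begin
    x           ≈⟨ undo x ⟨
    r * (c * x) ≤⟨ *-monoʳ-≤-nonNeg (<⇒≤ (inverse-positive cr≈1 0<c)) cx≤cy ⟩
    r * (c * y) ≈⟨ undo y ⟩
    y           ∎
    where
    undo : ∀ z → r * (c * z) ≈ z
    undo z = trans (sym (*-assoc r c z))
                   (trans (*-congʳ (trans (*-comm r c) cr≈1)) (*-identityˡ z))

  *-positive : ∀ {x y} → 0# < x → 0# < y → 0# < x * y
  *-positive {x} {y} 0<x 0<y = ≰⇒> (λ xy≤0 → <⇒≱ 0<y (*-cancelˡ-≤-pos 0<x (begin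
    x * y  ≤⟨ xy≤0 ⟩
    0#     ≈⟨ zeroʳ x ⟨
    x * 0# ∎)))

  convexCombination : ∀ {r s t} → r ≤ s → s ≤ t →
    ∃[ α ] ∃[ β ] 0# ≤ α × 0# ≤ β × α + β ≈ 1# × α * r + β * t ≈ s
  convexCombination {r} {s} {t} r≤s s≤t with em {P = r ≈ t}
  ... | yes r≈t = 1# , 0# , <⇒≤ 0<1 , ≤.refl , +-identityʳ 1# , (begin-equality
    1# * r + 0# * t ≈⟨ +-cong (*-identityˡ r) (zeroˡ t) ⟩
    r + 0#          ≈⟨ +-identityʳ r ⟩
    r               ≈⟨ ≤.antisym r≤s (≤.trans s≤t (≤.reflexive (sym r≈t))) ⟩
    s               ∎)
  ... | no r≉t =
    -- The weights are (t - s) / (t - r) and (s - r) / (t - r): `c` inverts `q + p`, which is t - r.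
    α , β , *-nonNegative 0≤q 0≤c , *-nonNegative 0≤p 0≤c , α+β≈1 , (begin-equality
      α * r + β * t           ≈⟨ +-congˡ (*-congˡ (//-rightDividesˡ s t)) ⟨
      α * r + β * (q + s)     ≈⟨ +-congˡ (distribˡ β q s) ⟩
      α * r + (β * q + β * s) ≈⟨ +-congˡ (+-congʳ ([x*y]*z≈[z*y]*x p c q)) ⟩
      α * r + (α * p + β * s) ≈⟨ +-assoc _ _ _ ⟨
      α * r + α * p + β * s   ≈⟨ +-congʳ (distribˡ α r p) ⟨
      α * (r + p) + β * s     ≈⟨ +-congʳ (*-congˡ r+p≈s) ⟩
      α * s + β * s           ≈⟨ distribʳ s α β ⟨
      (α + β) * s             ≈⟨ *-congʳ α+β≈1 ⟩
      1# * s                  ≈⟨ *-identityˡ s ⟩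
      s                       ∎)
    where
    p q : Carrier
    p = s - r
    q = t - s
    0≤p : 0# ≤ p
    0≤p = x≤y⇒0≤y-x r≤s
    0≤q : 0# ≤ q
    0≤q = x≤y⇒0≤y-x s≤t
    r+p≈s : r + p ≈ s
    r+p≈s = trans (+-comm r p) (//-rightDividesˡ r s)
    q+p≉0 : q + p ≉ 0#
    q+p≉0 q+p≈0 = r≉t (begin-equality
      r           ≈⟨ +-identityˡ r ⟨
      0# + r      ≈⟨ +-congʳ q+p≈0 ⟨
      q + p + r   ≈⟨ +-assoc q p r ⟩
      q + (p + r) ≈⟨ +-congˡ (//-rightDividesˡ r s) ⟩
      q + s       ≈⟨ //-rightDividesˡ s t ⟩
      t           ∎)
    c : Carrier
    c = proj₁ (inverse (q + p) q+p≉0)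
    α β : Carrier
    α = q * c
    β = p * c
    α+β≈1 : α + β ≈ 1#
    α+β≈1 = trans (sym (distribʳ c q p)) (proj₂ (inverse (q + p) q+p≉0))
    0≤c : 0# ≤ c
    0≤c = inverse-nonNeg (proj₂ (inverse (q + p) q+p≉0)) (begin
      0#      ≈⟨ +-identityʳ 0# ⟨
      0# + 0# ≤⟨ +-mono-≤ 0≤q 0≤p ⟩
      q + p   ∎)

  -- Stands in for a limit as δ tends to 0 from above. Asking for all δ up to a radius makes the
  -- notion closed under finite conjunctions, by passing to the smaller radius.
  ForSmall : Pred Carrier ℓ → Set ℓ
  ForSmall Q = ∃[ ε ] 0# < ε × (∀ {δ} → 0# < δ → δ ≤ ε → δ ∈ Q)

  forSmall-All : ∀ {Q : X → Pred Carrier ℓ} {xs} →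
                 All (λ x → ForSmall (Q x)) xs → ForSmall (λ δ → All (λ x → δ ∈ Q x) xs)
  forSmall-All [] = 1# , 0<1 , λ _ _ → []
  forSmall-All ((ε , 0<ε , small) ∷ qs) with forSmall-All qs
  ... | ε′ , 0<ε′ , smalls with ≤.total ε ε′
  ...   | inj₁ ε≤ε′ = ε , 0<ε , λ 0<δ δ≤ε → small 0<δ δ≤ε ∷ smalls 0<δ (≤.trans δ≤ε ε≤ε′)
  ...   | inj₂ ε′≤ε = ε′ , 0<ε′ , λ 0<δ δ≤ε′ → small 0<δ (≤.trans δ≤ε′ ε′≤ε) ∷ smalls 0<δ δ≤ε′

  pick : {Q : Pred Carrier ℓ} → ForSmall Q → ∃[ ε ] 0# < ε × ε ∈ Q
  pick (ε , 0<ε , small) = ε , 0<ε , small 0<ε ≤.refl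

  small-multiple : ∀ {x m} → 0# < x → 0# ≤ m → ForSmall (λ δ → δ * m < x)
  -- The radius is x / (1 + m): the added 1 keeps the denominator invertible when `m` is 0 and makes
  -- the bound strict.
  small-multiple {x} {m} 0<x 0≤m = ε , 0<ε , λ {δ} 0<δ δ≤ε → begin-strict
      δ * m     ≈⟨ *-comm δ m ⟩
      m * δ     ≤⟨ *-monoʳ-≤-nonNeg 0≤m δ≤ε ⟩
      m * ε     <⟨ x<x+y 0<ε ⟩
      m * ε + ε          ≈⟨ +-comm (m * ε) ε ⟩
      ε + m * ε          ≈⟨ +-congʳ (*-identityˡ ε) ⟨
      1# * ε + m * ε     ≈⟨ distribʳ ε 1# m ⟨
      (1# + m) * (x * r) ≈⟨ x*[y*z]≈y*[x*z] (1# + m) x r ⟩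
      x * ((1# + m) * r) ≈⟨ *-congˡ 1+m*r≈1 ⟩
      x * 1#    ≈⟨ *-identityʳ x ⟩
      x         ∎
    where
    0<1+m : 0# < 1# + m
    0<1+m = begin-strict
      0#      <⟨ 0<1 ⟩
      1#      ≈⟨ +-identityʳ 1# ⟨
      1# + 0# ≤⟨ +-monoʳ-≤ 1# 0≤m ⟩
      1# + m  ∎
    r : Carrier
    r = proj₁ (inverse (1# + m) (proj₂ 0<1+m ∘ sym))
    1+m*r≈1 : (1# + m) * r ≈ 1#
    1+m*r≈1 = proj₂ (inverse (1# + m) (proj₂ 0<1+m ∘ sym))
    ε : Carrier
    ε = x * r
    0<ε : 0# < ε
    0<ε = *-positive 0<x (inverse-positive 1+m*r≈1 0<1+m)

  -- If `c ≤ e` the gap does not shrink and any radius will do; otherwise it shrinks by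
  -- `δ * (c - e)`, which must stay below `y - x`.
  small-perturbation : ∀ {x y} c e → x < y → ForSmall (λ δ → x + δ * c < y + δ * e)
  small-perturbation {x} {y} c e x<y with ≤.total c e
  ... | inj₁ c≤e = 1# , 0<1 , λ {δ} 0<δ _ → begin-strict
    x + δ * c <⟨ +-monoˡ-< (δ * c) x<y ⟩
    y + δ * c ≤⟨ +-monoʳ-≤ y (*-monoʳ-≤-nonNeg (<⇒≤ 0<δ) c≤e) ⟩
    y + δ * e ∎
  ... | inj₂ e≤c = let (ε , 0<ε , small) = small-multiple 0<y-x (x≤y⇒0≤y-x e≤c) in
    ε , 0<ε , λ {δ} 0<δ δ≤ε → begin-strict
    x + δ * c                     ≈⟨ +-congˡ (*-congˡ (//-rightDividesˡ e c)) ⟨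
    x + δ * ((c - e) + e)         ≈⟨ +-congˡ (distribˡ δ (c - e) e) ⟩
    x + (δ * (c - e) + δ * e)     ≈⟨ x+[y+z]≈y+[x+z] x (δ * (c - e)) (δ * e) ⟩
    δ * (c - e) + (x + δ * e)     <⟨ +-monoˡ-< (x + δ * e) (small 0<δ δ≤ε) ⟩
    (y - x) + (x + δ * e)         ≈⟨ +-assoc (y - x) x (δ * e) ⟨
    (y - x) + x + δ * e           ≈⟨ +-congʳ (//-rightDividesˡ x y) ⟩
    y + δ * e                     ∎
    where
    0<y-x : 0# < y - x
    0<y-x = ≰⇒> (λ y-x≤0 → <⇒≱ x<y (≤.trans (≤-moveˡ⁻ y-x≤0) (≤.reflexive (+-identityˡ x))))

-- Weighted counts over finite formal combinations.

module Weight (em : ∀ {ℓ} → ExcludedMiddle ℓ) (ℝ : Reals) where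

  open Reals ℝ hiding (zero) renaming (refl to ≈-refl)
  open CommutativeSemigroupProperties +-commutativeSemigroup using (interchange)
  open Equivalence using (to; from)

  _when_ : Carrier → Set ℓ → Carrier
  c when Q = if does (em {P = Q}) then c else 0#

  when-cong : ∀ {c} {Q : Set ℓ₁} {R : Set ℓ₂} → Q ⇔ R → c when Q ≈ c when R
  when-cong {Q = Q} {R = R} Q⇔R with em {P = Q} | em {P = R}
  ... | yes _ | yes _ = ≈-refl
  ... | no _  | no _  = ≈-refl
  ... | yes q | no ¬r = contradiction (to Q⇔R q) ¬r
  ... | no ¬q | yes r = contradiction (from Q⇔R r) ¬q

  when-no : ∀ {c} {Q : Set ℓ} → ¬ Q → c when Q ≈ 0#
  when-no {Q = Q} ¬q with em {P = Q}
  ... | yes q = contradiction q ¬q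
  ... | no _  = ≈-refl

  when-split : ∀ {c} (Q : Set ℓ₁) (R : Set ℓ₂) → c when Q ≈ c when (Q × R) + c when (Q × ¬ R)
  when-split {c = c} Q R with em {P = Q} | em {P = R} | em {P = Q × R} | em {P = Q × ¬ R}
  ... | yes _ | _     | yes _        | no _          = sym (+-identityʳ c)
  ... | yes _ | _     | no _         | yes _         = sym (+-identityˡ c)
  ... | no _  | _     | no _         | no _          = sym (+-identityˡ 0#)
  ... | _     | _     | yes (_ , r)  | yes (_ , ¬r)  = contradiction r ¬r
  ... | yes q | yes r | no ¬qr       | no _          = contradiction (q , r) ¬qr
  ... | yes q | no ¬r | no _         | no ¬q¬r       = contradiction (q , ¬r) ¬q¬r
  ... | no ¬q | _     | yes (q , _)  | _             = contradiction q ¬q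
  ... | no ¬q | _     | _            | yes (q , _)   = contradiction q ¬q

  -- With `Q = (w ∈_)` this is the value at `w` of a combination of indicators; with
  -- `Q = Satisfiable`, on open convex sets, it is the Euler characteristic. Leaving `X` arbitrary
  -- lets intervals, convex sets and polyhedra share the same calculus.
  weight : Pred X ℓ → List (Carrier × X) → Carrier
  weight Q []            = 0#
  weight Q ((c , x) ∷ L) = c when (x ∈ Q) + weight Q L

  weight-cong : {Q : Pred X ℓ₁} {R : Pred X ℓ₂} {L : List (Carrier × X)} →
                All (λ (_ , x) → x ∈ Q ⇔ x ∈ R) L → weight Q L ≈ weight R L
  weight-cong []       = ≈-refl
  weight-cong (e ∷ es) = +-cong (when-cong e) (weight-cong es)

  weight-none : {Q : Pred X ℓ} {L : List (Carrier × X)} →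
                All (λ (_ , x) → ¬ x ∈ Q) L → weight Q L ≈ 0#
  weight-none []       = ≈-refl
  weight-none (n ∷ ns) = trans (+-cong (when-no n) (weight-none ns)) (+-identityˡ 0#)

  weight-⇔ : {Q : Pred X ℓ₁} {R : Pred X ℓ₂} (L : List (Carrier × X)) →
             (∀ x → x ∈ Q ⇔ x ∈ R) → weight Q L ≈ weight R L
  weight-⇔ L e = weight-cong {L = L} (All.universal (λ (_ , x) → e x) L)

  weight-∅ : {Q : Pred X ℓ} (L : List (Carrier × X)) → (∀ x → ¬ x ∈ Q) → weight Q L ≈ 0#
  weight-∅ L n = weight-none {L = L} (All.universal (λ (_ , x) → n x) L)

  weight-split : (Q : Pred X ℓ₁) (R : Pred X ℓ₂) (L : List (Carrier × X)) →
                 weight Q L ≈ weight (Q ∩ R) L + weight (Q ∩ ∁ R) L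
  weight-split Q R []            = sym (+-identityˡ 0#)
  weight-split Q R ((c , x) ∷ L) =
    trans (+-cong (when-split (x ∈ Q) (x ∈ R)) (weight-split Q R L)) (interchange _ _ _ _)

  weight-map₂ : (Q : Pred Y ℓ) (g : X → Y) (L : List (Carrier × X)) →
                weight Q (List.map (map₂ g) L) ≈ weight (Q ∘ g) L
  weight-map₂ Q g []      = ≈-refl
  weight-map₂ Q g (_ ∷ L) = +-congˡ (weight-map₂ Q g L)

  weight-++ : (Q : Pred X ℓ) (L K : List (Carrier × X)) →
              weight Q (L ++ K) ≈ weight Q L + weight Q K
  weight-++ Q []      K = sym (+-identityˡ _)
  weight-++ Q (_ ∷ L) K = trans (+-congˡ (weight-++ Q L K)) (sym (+-assoc _ _ _))

  module _ {_~_ : Rel X ℓ} (~-refl : ∀ {x} → x ~ x)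
           (~-sym : Symmetric _~_) (~-trans : Transitive _~_)
           {L : List (Carrier × X)} where

    -- A saturated `Q` is a union of classes, and only the finitely many classes represented in `L`
    -- carry weight, so they can be split off one at a time until nothing is left.
    weight-classes : {Q : Pred X ℓ} → (∀ {x y} → x ~ y → x ∈ Q → y ∈ Q) →
                     All (λ (_ , k) → k ∈ Q → weight (k ~_) L ≈ 0#) L → weight Q L ≈ 0#
    weight-classes sat classes =
      peel L sat classes (All.tabulate λ {(_ , x)} x∈L _ → Any.map (λ { ≡.refl → ~-refl }) x∈L)
      where
      -- K lists representatives of all the classes on which Q may hold.
      peel : ∀ K {Q : Pred X ℓ} → (∀ {x y} → x ~ y → x ∈ Q → y ∈ Q) →
             All (λ (_ , k) → k ∈ Q → weight (k ~_) L ≈ 0#) K →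
             All (λ (_ , x) → x ∈ Q → Any (λ (_ , k) → k ~ x) K) L → weight Q L ≈ 0#
      peel [] _ _ reps = weight-none (All.map (λ rep q → contradiction (rep q) λ ()) reps)
      peel ((_ , k) ∷ K) {Q} sat (class ∷ classes) reps = trans (weight-split Q (k ~_) L) (trans
        (+-cong kPart (peel K
          (λ x~y (q , k≁x) → sat x~y q , λ k~y → k≁x (~-trans k~y (~-sym x~y)))
          (All.map (λ c (q , _) → c q) classes)
          (All.map (λ { rep (q , k≁x) → tailRep k≁x (rep q) }) reps)))
        (+-identityˡ 0#))
        where
        tailRep : ∀ {x} → ¬ k ~ x → Any (λ (_ , k′) → k′ ~ x) ((_ , k) ∷ K) →
                  Any (λ (_ , k′) → k′ ~ x) K
        tailRep k≁x (here k~x) = contradiction k~x k≁x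
        tailRep _   (there r)  = r

        -- By saturation `Q` either contains the class of `k` or misses it; `class` settles the
        -- first case.
        kPart : weight (Q ∩ (k ~_)) L ≈ 0#
        kPart with em {P = k ∈ Q}
        ... | yes q = trans (weight-⇔ L λ _ → mk⇔ proj₂ (λ k~x → sat k~x q , k~x)) (class q)
        ... | no ¬q = weight-∅ L λ _ (q , k~x) → ¬q (sat (~-sym k~x) q)

-- The Euler characteristic of open intervals on the line.

module Intervals (em : ∀ {ℓ} → ExcludedMiddle ℓ) (ℝ : Reals) where

  open Reals ℝ hiding (zero) renaming (refl to ≈-refl)
  open OrderedField em ℝ
  open Weight em ℝ

  -- Openness is expressed by the absence of extremal points, so empty and unbounded intervals fit
  -- the definition without endpoints being named.
  record IsOpenInterval (J : Pred Carrier 0ℓ) : Set where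
    field
      between : ∀ {r s t} → r ∈ J → t ∈ J → r ≤ s → s ≤ t → s ∈ J
      below   : ∀ {t} → t ∈ J → ∃[ s ] s ∈ J × s < t
      above   : ∀ {t} → t ∈ J → ∃[ s ] s ∈ J × t < s

  open IsOpenInterval

  infix 4 _⊑_ _~_

  -- For nonempty open intervals this says sup J ≤ sup K, including the case where a supremum is
  -- infinite.
  _⊑_ : Rel (Pred Carrier 0ℓ) 0ℓ
  J ⊑ K = ∀ t → t ∈ J → ∃[ s ] s ∈ K × t ≤ s

  ⊑-refl : ∀ {J} → J ⊑ J
  ⊑-refl t t∈J = t , t∈J , ≤.refl

  ⊑-trans : ∀ {J K L} → J ⊑ K → K ⊑ L → J ⊑ L
  ⊑-trans J⊑K K⊑L t t∈J =
    let (s , s∈K , t≤s) = J⊑K t t∈J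
        (r , r∈L , s≤r) = K⊑L s s∈K
    in r , r∈L , ≤.trans t≤s s≤r

  ⋢-witness : ∀ {J K} → ¬ J ⊑ K → ∃[ t ] t ∈ J × ¬ (∃[ s ] s ∈ K × t ≤ s)
  ⋢-witness {J} {K} J⋢K with em {P = ∃[ t ] t ∈ J × ¬ (∃[ s ] s ∈ K × t ≤ s)}
  ... | yes w = w
  ... | no ¬w = contradiction J⊑K J⋢K
    where
    J⊑K : J ⊑ K
    J⊑K t t∈J with em {P = ∃[ s ] s ∈ K × t ≤ s}
    ... | yes w = w
    ... | no ¬t = contradiction (t , t∈J , ¬t) ¬w

  -- Two nonempty intervals are related when they have the same supremum.
  _~_ : Rel (Pred Carrier 0ℓ) 0ℓ
  J ~ K = J ⊑ K × K ⊑ J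

  module _ (K : Pred Carrier 0ℓ) (K-open : IsOpenInterval K) {k : Carrier} (k∈K : k ∈ K) where

    -- J contains all points of K close to sup K.
    Crosses : Pred (Pred Carrier 0ℓ) 0ℓ
    Crosses J = (∃[ t ] t ∈ J × ∃[ s ] s ∈ K × t ≤ s) × K ⊑ J

    -- The filter of left neighbourhoods of sup K inside `K`, again without assuming that the
    -- supremum is finite.
    NearTop : Pred Carrier ℓ → Set ℓ
    NearTop Q = ∃[ t ] t ∈ K × (∀ {s} → s ∈ K → t ≤ s → s ∈ Q)

    nearTop-All : ∀ {Q : X → Pred Carrier ℓ} {xs} →
                  All (λ x → NearTop (Q x)) xs → NearTop (λ s → All (λ x → s ∈ Q x) xs)
    nearTop-All [] = k , k∈K , λ _ _ → []
    nearTop-All ((t , t∈K , near) ∷ qs) with nearTop-All qs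
    ... | t′ , t′∈K , nears with ≤.total t t′
    ...   | inj₁ t≤t′ = t′ , t′∈K , λ s∈K t′≤s → near s∈K (≤.trans t≤t′ t′≤s) ∷ nears s∈K t′≤s
    ...   | inj₂ t′≤t = t , t∈K , λ s∈K t≤s → near s∈K t≤s ∷ nears s∈K (≤.trans t′≤t t≤s)

    -- There are three positions. If `K ⊑ J` fails, points of `K` far enough up lie beyond `J`. If
    -- it holds and some point of `J` lies under a point of `K`, order convexity puts all of `K`
    -- from there on inside `J`. Otherwise `J` lies entirely above `K`.
    crosses-nearTop : ∀ {J} → IsOpenInterval J → NearTop (λ t → t ∈ J ⇔ J ∈ Crosses)
    crosses-nearTop {J} J-open with em {P = K ⊑ J}
    ... | no K⋢J =
      let (t , t∈K , ¬t) = ⋢-witness K⋢J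
      in t , t∈K , λ {s} _ t≤s → mk⇔ (λ s∈J → contradiction (s , s∈J , t≤s) ¬t)
                                     (λ (_ , K⊑J) → contradiction K⊑J K⋢J)
    ... | yes K⊑J with em {P = ∃[ t ] t ∈ J × ∃[ s ] s ∈ K × t ≤ s}
    ...   | yes m@(r , r∈J , t , t∈K , r≤t) = t , t∈K , λ {s} s∈K t≤s →
      let (s′ , s′∈J , s≤s′) = K⊑J s s∈K
      in mk⇔ (λ _ → m , K⊑J) (λ _ → between J-open r∈J s′∈J (≤.trans r≤t t≤s) s≤s′)
    ...   | no ¬m = k , k∈K , λ {s} s∈K _ →
      mk⇔ (λ s∈J → contradiction (s , s∈J , s , s∈K , ≤.refl) ¬m) (λ (m , _) → contradiction m ¬m)

    module _ {b : Carrier} (ub : ∀ t → t ∈ K → t ≤ b)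
             (least : ∀ c → (∀ t → t ∈ K → t ≤ c) → b ≤ c) where

      -- If `b ∈ J`, openness gives a point of `J` below `b`, hence below some point of `K`, while
      -- `J ⊑ K` would force `K` to reach its own supremum. Conversely, a crossing `J` that leaves
      -- `K` has points on both sides of `b`.
      supremum∈⇔ : ∀ {J} → IsOpenInterval J → b ∈ J ⇔ (J ∈ Crosses × ¬ J ⊑ K)
      supremum∈⇔ {J} J-open = mk⇔ forth back
        where
        forth : b ∈ J → J ∈ Crosses × ¬ J ⊑ K
        forth b∈J = (meets , λ t t∈K → b , b∈J , ub t t∈K) , λ J⊑K →
          let (s , s∈K , b≤s)    = J⊑K b b∈J
              (s′ , s′∈K , s<s′) = above K-open s∈K
          in <⇒≱ s<s′ (≤.trans (ub s′ s′∈K) b≤s)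
          where
          meets : ∃[ t ] t ∈ J × ∃[ s ] s ∈ K × t ≤ s
          meets with below J-open b∈J
          ... | s , s∈J , s<b with em {P = ∃[ t ] t ∈ K × s ≤ t}
          ...   | yes w = s , s∈J , w
          ...   | no ¬w = contradiction (least s λ t t∈K → ≰⇒≥ λ s≤t → ¬w (t , t∈K , s≤t)) (<⇒≱ s<b)

        back : J ∈ Crosses × ¬ J ⊑ K → b ∈ J
        back (((r , r∈J , s , s∈K , r≤s) , _) , J⋢K) =
          let (t , t∈J , ¬t) = ⋢-witness J⋢K
          in between J-open r∈J t∈J (≤.trans r≤s (ub s s∈K))
               (least t λ s s∈K → ≰⇒≥ λ t≤s → ¬t (s , s∈K , t≤s))

    module _ {L : List (Carrier × Pred Carrier 0ℓ)}
             (L-open : All (λ (_ , J) → IsOpenInterval J) L)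
             (vanishes : ∀ t → weight (t ∈_) L ≈ 0#) where

      -- This is the value of the combination at one point of `K`, taken close enough to sup K for
      -- all entries of `L` at once.
      weight-crosses : weight Crosses L ≈ 0#
      weight-crosses =
        let (t , t∈K , near) = nearTop-All (All.map crosses-nearTop L-open)
        in trans (sym (weight-cong (near t∈K ≤.refl))) (vanishes t)

      -- If `K` is bounded, this is the value of the combination at sup K. If not, no interval
      -- contributes: a point of `J` above all of `K` would be an upper bound.
      weight-crosses-⋢ : weight (Crosses ∩ ∁ (_⊑ K)) L ≈ 0#
      weight-crosses-⋢ with em {P = ∃[ b ] (∀ t → t ∈ K → t ≤ b)}
      ... | yes bounded =
        let (b , ub , least) = supremum K (k , k∈K) bounded
        in trans (sym (weight-cong (All.map (supremum∈⇔ ub least) L-open))) (vanishes b)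
      ... | no unbounded = weight-∅ L (λ _ (_ , J⋢K) →
        let (t , _ , ¬t) = ⋢-witness J⋢K
        in unbounded (t , λ s s∈K → ≰⇒≥ λ t≤s → ¬t (s , s∈K , t≤s)))

      -- The weight of the class of K is the jump at sup K of the function
      -- t ↦ weight (t ∈_) L: its value just below minus its value there.
      weight-class : weight (K ~_) L ≈ 0#
      weight-class = begin
        weight (K ~_) L
          ≈⟨ weight-⇔ L (λ _ → mk⇔ forth (λ ((_ , K⊑J) , J⊑K) → K⊑J , J⊑K)) ⟩
        weight (Crosses ∩ (_⊑ K)) L
          ≈⟨ +-identityʳ _ ⟨
        weight (Crosses ∩ (_⊑ K)) L + 0#
          ≈⟨ +-congˡ weight-crosses-⋢ ⟨
        weight (Crosses ∩ (_⊑ K)) L + weight (Crosses ∩ ∁ (_⊑ K)) L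
          ≈⟨ weight-split Crosses (_⊑ K) L ⟨
        weight Crosses L
          ≈⟨ weight-crosses ⟩
        0# ∎
        where
        open SetoidReasoning setoid
        forth : ∀ {J} → K ~ J → (Crosses ∩ (_⊑ K)) J
        forth (K⊑J , J⊑K) = let (r , r∈J , _) = K⊑J k k∈K in ((r , r∈J , J⊑K r r∈J) , K⊑J) , J⊑K

  -- Each nonempty interval is counted at its supremum. Grouping by suprema turns the total into a
  -- sum of jumps of a function that is identically zero.
  euler-intervals : ∀ {L} → All (λ (_ , J) → IsOpenInterval J) L →
                    (∀ t → weight (t ∈_) L ≈ 0#) → weight Satisfiable L ≈ 0#
  euler-intervals L-open vanishes = weight-classes
    (λ {J} → ⊑-refl {J} , ⊑-refl {J})
    (λ (J⊑K , K⊑J) → K⊑J , J⊑K)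
    (λ {J} {K} {L} (J⊑K , K⊑J) (K⊑L , L⊑K) →
      ⊑-trans {J} {K} {L} J⊑K K⊑L , ⊑-trans {L} {K} {J} L⊑K K⊑J)
    (λ (J⊑K , _) (t , t∈J) → let (s , s∈K , _) = J⊑K t t∈J in s , s∈K)
    (All.map (λ {(_ , K)} K-open (k , k∈K) → weight-class K K-open k∈K L-open vanishes) L-open)

-- The Euler characteristic of open convex sets, by slicing.

module OpenConvex (em : ∀ {ℓ} → ExcludedMiddle ℓ) (ℝ : Reals) where

  open Reals ℝ hiding (zero) renaming (refl to ≈-refl)
  open OrderedField em ℝ
  open Weight em ℝ
  open Intervals em ℝ
  open LinearInequalities em ℝ
  open PosetReasoning poset

  -- Openness is asked only along lines, with a step depending on the direction. This passes to
  -- slices at once and is enough to make projections to an axis open.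
  record IsOpenConvex (S : Pred (Vector Carrier n) 0ℓ) : Set where
    field
      resp   : ∀ {x y : Vector Carrier n} → x ≋ y → x ∈ S → y ∈ S
      convex : ∀ {α β} → 0# ≤ α → 0# ≤ β → α + β ≈ 1# → ∀ {x y : Vector Carrier n} → x ∈ S → y ∈ S →
               (λ i → α * x i + β * y i) ∈ S
      opens  : ∀ {x : Vector Carrier n} → x ∈ S → ∀ (w : Vector Carrier n) →
               ∃[ ε ] 0# < ε × (λ i → x i + ε * w i) ∈ S

  open IsOpenConvex

  Slice : Carrier → Pred (Vector Carrier (suc n)) 0ℓ → Pred (Vector Carrier n) 0ℓ
  Slice t S y = (t Vector.∷ y) ∈ S

  slice-isOpenConvex : ∀ t {S : Pred (Vector Carrier (suc n)) 0ℓ} →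
                       IsOpenConvex S → IsOpenConvex (Slice t S)
  slice-isOpenConvex t S-oc = record
    { resp   = λ y≋z → resp S-oc λ { zero → ≈-refl ; (suc i) → y≋z i }
    ; convex = λ {α} {β} 0≤α 0≤β α+β≈1 y∈ z∈ → resp S-oc
        (λ { zero    → trans (sym (distribʳ t α β)) (trans (*-congʳ α+β≈1) (*-identityˡ t))
           ; (suc i) → ≈-refl })
        (convex S-oc 0≤α 0≤β α+β≈1 y∈ z∈)
    ; opens  = λ y∈ w →
        let (ε , 0<ε , y+εw∈) = opens S-oc y∈ (0# Vector.∷ w)
        in ε , 0<ε , resp S-oc
             (λ { zero → trans (+-congˡ (zeroʳ ε)) (+-identityʳ t) ; (suc i) → ≈-refl }) y+εw∈
    }

  -- Convex combinations of points over `r` and `t` fill the gap between them; a short move along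
  -- the first axis in either direction rules out extremal values.
  shadow-isOpenInterval : {S : Pred (Vector Carrier (suc n)) 0ℓ} →
                          IsOpenConvex S → IsOpenInterval (λ t → Satisfiable (Slice t S))
  shadow-isOpenInterval {S = S} S-oc = record
    { between = λ (x , rx∈S) (y , ty∈S) r≤s s≤t →
        let (α , β , 0≤α , 0≤β , α+β≈1 , αr+βt≈s) = convexCombination r≤s s≤t
        in (λ i → α * x i + β * y i)
         , resp S-oc (λ { zero → αr+βt≈s ; (suc i) → ≈-refl }) (convex S-oc 0≤α 0≤β α+β≈1 rx∈S ty∈S)
    ; below = λ {t} (y , ty∈S) →
        let (ε , 0<ε , t+ε-1∈S) = opens S-oc ty∈S (- 1# Vector.∷ 0ᵥ)
        in t + ε * - 1# , (_ , resp S-oc (λ { zero → ≈-refl ; (suc i) → ≈-refl }) t+ε-1∈S) , (begin-strict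
             t + ε * - 1#       <⟨ +-monoʳ-< t (ε*-1<0 0<ε) ⟩
             t + 0#             ≈⟨ +-identityʳ t ⟩
             t                  ∎)
    ; above = λ {t} (y , ty∈S) →
        let (ε , 0<ε , t+ε∈S) = opens S-oc ty∈S (1# Vector.∷ 0ᵥ)
        in t + ε * 1# , (_ , resp S-oc (λ { zero → ≈-refl ; (suc i) → ≈-refl }) t+ε∈S) , (begin-strict
             t                  <⟨ x<x+y 0<ε ⟩
             t + ε              ≈⟨ +-congˡ (*-identityʳ ε) ⟨
             t + ε * 1#         ∎)
    }
    where
    ε*-1<0 : ∀ {ε} → 0# < ε → ε * - 1# < 0#
    ε*-1<0 {ε} 0<ε = begin-strict
      ε * - 1#           <⟨ x<x+y 0<ε ⟩
      ε * - 1# + ε       ≈⟨ +-congˡ (*-identityʳ ε) ⟨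
      ε * - 1# + ε * 1#  ≈⟨ distribˡ ε (- 1#) 1# ⟨
      ε * (- 1# + 1#)    ≈⟨ *-congˡ (-‿inverseˡ 1#) ⟩
      ε * 0#             ≈⟨ zeroʳ ε ⟩
      0#                 ∎

  -- Induction on the dimension. The slices at first coordinate `t` satisfy the hypotheses one
  -- dimension lower, so the combination of shadows on the first axis vanishes at every `t`, and the
  -- result for intervals applies.
  euler : ∀ n {L : List (Carrier × Pred (Vector Carrier n) 0ℓ)} →
          All (λ (_ , S) → IsOpenConvex S) L →
          (∀ x → weight (x ∈_) L ≈ 0#) → weight Satisfiable L ≈ 0#
  euler zero L-oc vanishes = trans
    (weight-cong (All.map (λ S-oc → mk⇔ (λ (x , x∈S) → resp S-oc (λ ()) x∈S) (_ ,_)) L-oc))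
    (vanishes Vector.[])
  euler (suc n) {L} L-oc vanishes = trans
    (weight-cong (All.map (λ S-oc → mk⇔
      (λ (x , x∈S) → x zero , x ∘ suc , resp S-oc (λ { zero → ≈-refl ; (suc i) → ≈-refl }) x∈S)
      (λ (t , y , ty∈S) → _ , ty∈S)) L-oc))
    (trans (sym (weight-map₂ Satisfiable shadow L)) (euler-intervals
      (AllP.map⁺ (All.map shadow-isOpenInterval L-oc))
      λ t → trans (weight-map₂ (t ∈_) shadow L) (trans (sym (weight-map₂ Satisfiable (Slice t) L)) (euler n
        (AllP.map⁺ (All.map (slice-isOpenConvex t) L-oc))
        λ y → trans (weight-map₂ (y ∈_) (Slice t) L) (vanishes (t Vector.∷ y))))))
    where
    shadow : Pred (Vector Carrier (suc n)) 0ℓ → Pred Carrier 0ℓ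
    shadow S t = Satisfiable (Slice t S)

-- Linear functionals on finitely supported sets.

module Supports (em : ∀ {ℓ} → ExcludedMiddle ℓ) (ℝ : Reals) where

  open Reals ℝ hiding (zero) renaming (refl to ≈-refl)
  open OrderedField em ℝ
  open OpenConvex em ℝ using (IsOpenConvex)
  open LinearInequalities em ℝ
  open FourierMotzkin public using (·-congʳ; ·-distribˡ; ·-distribʳ; ·-scaleˡ; ·-zeroˡ)
  open PosetReasoning poset
  open Extrema ≤-totalOrder using (argmax; argmax-all; f[xs]≤f[argmax])

  ·-congˡ : ∀ {u v : Vector Carrier n} → u ≋ v → ∀ x → u · x ≈ v · x
  ·-congˡ u≋v x = sum-cong-≋ (λ i → *-congʳ (u≋v i))

  ·-perturb : ∀ (u w : Vector Carrier n) ε x → (λ i → u i + ε * w i) · x ≈ u · x + ε * (w · x)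
  ·-perturb u w ε x = trans (·-distribʳ u (Vector.map (ε *_) w) x) (+-congˡ (·-scaleˡ ε w x))

  ·-combination : ∀ α β (u v x : Vector Carrier n) →
                  (λ i → α * u i + β * v i) · x ≈ α * (u · x) + β * (v · x)
  ·-combination α β u v x = trans (·-distribʳ (Vector.map (α *_) u) (Vector.map (β *_) v) x)
                                  (+-cong (·-scaleˡ α u x) (·-scaleˡ β v x))

  unit : Fin n → Vector Carrier n
  unit zero    = 1# Vector.∷ 0ᵥ
  unit (suc i) = 0# Vector.∷ unit i

  unit-· : ∀ (i : Fin n) x → unit i · x ≈ x i
  unit-· zero    x = trans (+-cong (*-identityˡ (x zero)) (·-zeroˡ (Vector.tail x))) (+-identityʳ _)
  unit-· (suc i) x = trans (+-cong (zeroˡ (x zero)) (unit-· i (Vector.tail x))) (+-identityˡ _)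

  unit-nonNeg : ∀ (i j : Fin n) → 0# ≤ unit i j
  unit-nonNeg zero    zero    = <⇒≤ 0<1
  unit-nonNeg zero    (suc j) = ≤.refl
  unit-nonNeg (suc i) zero    = ≤.refl
  unit-nonNeg (suc i) (suc j) = unit-nonNeg i j

  sum-unit : ∀ (i : Fin n) → sum (unit i) ≈ 1#
  sum-unit i = trans (sum-cong-≋ (λ j → sym (*-identityʳ (unit i j)))) (unit-· i (λ _ → 1#))

  sum-mono-≤ : ∀ {f g : Vector Carrier n} → (∀ i → f i ≤ g i) → sum f ≤ sum g
  sum-mono-≤ {zero}  f≤g = ≤.refl
  sum-mono-≤ {suc n} f≤g = +-mono-≤ (f≤g zero) (sum-mono-≤ (f≤g ∘ suc))

  Maximisers : Vector Carrier n → Pred (Vector Carrier n) 0ℓ → Pred (Vector Carrier n) 0ℓ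
  Maximisers u A x = x ∈ A × (∀ y → y ∈ A → u · y ≤ u · x)

  -- Every linear functional is dominated on `A` by its values on one finite subset of `A`.
  -- Polytopes have this property, and it passes to Minkowski sums and to faces without listing
  -- vertices.
  FinitelySupported : Pred (Vector Carrier n) 0ℓ → Set
  FinitelySupported A = ∃[ ps ] All (_∈ A) ps × (∀ u {x} → x ∈ A → Any (λ p → u · x ≤ u · p) ps)

  maximiser : {A : Pred (Vector Carrier n) 0ℓ} → FinitelySupported A → Satisfiable A →
              ∀ u → Satisfiable (Maximisers u A)
  maximiser (ps , ps⊆A , supported) (x , x∈A) u =
    argmax (u ·_) x ps , argmax-all (u ·_) x∈A ps⊆A , λ y y∈A →
      let (p , p∈ps , uy≤up) = find (supported u y∈A)
      in ≤.trans uy≤up (All.lookup (f[xs]≤f[argmax] {f = u ·_} x ps) p∈ps)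

  finitelySupported-resp-≐ : {A B : Pred (Vector Carrier n) 0ℓ} → A ≐ B →
                             FinitelySupported A → FinitelySupported B
  finitelySupported-resp-≐ (A⊆B , B⊆A) (ps , ps⊆A , supported) =
    ps , All.map A⊆B ps⊆A , λ u x∈B → supported u (B⊆A x∈B)

  origin-finitelySupported : FinitelySupported {n} (_≋ 0ᵥ)
  origin-finitelySupported =
    List.[ 0ᵥ ] , (λ _ → ≈-refl) ∷ [] , λ u x≋0 → here (≤.reflexive (·-congʳ u x≋0))

  minkowskiSum-finitelySupported : {A B : Pred (Vector Carrier n) 0ℓ} →
    FinitelySupported A → FinitelySupported B → FinitelySupported (MinkowskiSum A B)
  minkowskiSum-finitelySupported (ps , ps⊆A , A-supported) (qs , qs⊆B , B-supported) =
    List.cartesianProductWith _+ᵥ_ ps qs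
    , AllP.cartesianProductWith⁺ (≡P.setoid _) (≡P.setoid _) _+ᵥ_ ps qs
        (λ {p} {q} p∈ q∈ → p , q , All.lookup ps⊆A p∈ , All.lookup qs⊆B q∈ , λ _ → ≈-refl)
    , λ u {x} (y , z , y∈A , z∈B , x≋y+z) →
        let (p , p∈ , uy≤up) = find (A-supported u y∈A)
            (q , q∈ , uz≤uq) = find (B-supported u z∈B)
        in lose (∈-cartesianProductWith⁺ _+ᵥ_ p∈ q∈) (begin
          u · x         ≈⟨ ·-congʳ u x≋y+z ⟩
          u · (y +ᵥ z)  ≈⟨ ·-distribˡ u y z ⟩
          u · y + u · z ≤⟨ +-mono-≤ uy≤up uz≤uq ⟩
          u · p + u · q ≈⟨ ·-distribˡ u p q ⟨
          u · (p +ᵥ q)  ∎)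

  -- Each strict inequality has its own radius, and finitely many admit a common one. The
  -- implication inside allows `ps` to be a full finite support: points that fail `u · p < u · x`
  -- are passed over.
  forSmall-< : ∀ (u w x : Vector Carrier n) (ps : List (Vector Carrier n)) →
    ForSmall (λ δ → All (λ p → u · p < u · x → (λ i → u i + δ * w i) · p < (λ i → u i + δ * w i) · x) ps)
  forSmall-< u w x ps = forSmall-All (All.universal each ps)
    where
    each : ∀ p → ForSmall (λ δ → u · p < u · x → (λ i → u i + δ * w i) · p < (λ i → u i + δ * w i) · x)
    each p with em {P = u · p < u · x}
    ... | no up≮ux = 1# , 0<1 , λ _ _ up<ux → contradiction up<ux up≮ux
    ... | yes up<ux =
      let (ε , 0<ε , small) = small-perturbation (w · p) (w · x) up<ux
      in ε , 0<ε , λ {δ} 0<δ δ≤ε _ → begin-strict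
        (λ i → u i + δ * w i) · p ≈⟨ ·-perturb u w δ p ⟩
        u · p + δ * (w · p)       <⟨ small 0<δ δ≤ε ⟩
        u · x + δ * (w · x)       ≈⟨ ·-perturb u w δ x ⟨
        (λ i → u i + δ * w i) · x ∎

  perturb-cancel-≤ : ∀ {u w x y : Vector Carrier n} {δ} → 0# < δ → u · y ≤ u · x →
    (λ i → u i + δ * w i) · x ≤ (λ i → u i + δ * w i) · y → w · x ≤ w · y
  perturb-cancel-≤ {u = u} {w} {x} {y} {δ} 0<δ uy≤ux ux+δwx≤uy+δwy =
    *-cancelˡ-≤-pos 0<δ (+-cancelˡ-≤ (u · x) (begin
      u · x + δ * (w · x)        ≈⟨ ·-perturb u w δ x ⟨
      (λ i → u i + δ * w i) · x  ≤⟨ ux+δwx≤uy+δwy ⟩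
      (λ i → u i + δ * w i) · y  ≈⟨ ·-perturb u w δ y ⟩
      u · y + δ * (w · y)        ≤⟨ +-monoˡ-≤ _ uy≤ux ⟩
      u · x + δ * (w · y)        ∎))

  -- For small δ, a point of `ps` dominating `x` in direction u + δ w cannot lie below `x` in
  -- direction `u`. It therefore belongs to the face, and cancelling δ shows that it dominates `x`
  -- for `w`.
  maximisers-finitelySupported : ∀ u {A : Pred (Vector Carrier n) 0ℓ} →
    FinitelySupported A → FinitelySupported (Maximisers u A)
  maximisers-finitelySupported u {A} (ps , ps⊆A , supported) =
    List.filter (λ p → em {P = p ∈ Maximisers u A}) ps
    , AllP.all-filter (λ p → em {P = p ∈ Maximisers u A}) ps
    , λ w {x} (x∈A , max) →
      let (δ , 0<δ , small) = pick (forSmall-< u w x ps)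
          (p , p∈ps , le) = find (supported (λ i → u i + δ * w i) x∈A)
          ux≤up = ≮⇒≥ (λ up<ux → <⇒≱ (All.lookup small p∈ps up<ux) le)
      in lose (∈-filter⁺ (λ p → em {P = p ∈ Maximisers u A}) p∈ps
                 (All.lookup ps⊆A p∈ps , λ y y∈A → ≤.trans (max y y∈A) ux≤up))
              (perturb-cancel-≤ {u = u} 0<δ (max p (All.lookup ps⊆A p∈ps)) le)

  -- A maximiser of u that also maximises w among the maximisers of u maximises
  -- u + ε w for small ε, so maximising u + (u + ε w) means maximising both.
  maximisers-refine : {A : Pred (Vector Carrier n) 0ℓ} → FinitelySupported A → Satisfiable A →
    ∀ u w → ∃[ v ] (∀ {x} → x ∈ Maximisers v A → x ∈ Maximisers w (Maximisers u A))
  maximisers-refine {n} {A} A-fs@(ps , ps⊆A , supported) A-sat u w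
    = u +ᵥ u′ , λ {x} (x∈A , x-max) →
      let le      = begin
            u · p + u′ · p ≈⟨ ·-distribʳ u u′ p ⟨
            (u +ᵥ u′) · p  ≤⟨ x-max p p∈A ⟩
            (u +ᵥ u′) · x  ≈⟨ ·-distribʳ u u′ x ⟩
            u · x + u′ · x ∎
          up≤ux   = +-cancelʳ-≤ (u′ · p) (≤.trans le (+-monoʳ-≤ (u · x) (u′-max x∈A)))
          u′p≤u′x = +-cancelˡ-≤ (u · p) (≤.trans le (+-monoˡ-≤ (u′ · x) (p-max x x∈A)))
          wp≤wx   = perturb-cancel-≤ {u = u} 0<ε (p-max x x∈A) u′p≤u′x
      in (x∈A , λ y y∈A → ≤.trans (p-max y y∈A) up≤ux)
       , λ y y∈ → ≤.trans (p-max′ y y∈) wp≤wx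
    where
    best : Satisfiable (Maximisers w (Maximisers u A))
    best = maximiser (maximisers-finitelySupported u A-fs) (maximiser A-fs A-sat u) w

    p : Vector Carrier n
    p = proj₁ best
    p∈A : p ∈ A
    p∈A = proj₁ (proj₁ (proj₂ best))
    p-max : ∀ y → y ∈ A → u · y ≤ u · p
    p-max = proj₂ (proj₁ (proj₂ best))
    p-max′ : ∀ y → y ∈ Maximisers u A → w · y ≤ w · p
    p-max′ = proj₂ (proj₂ best)

    perturbation : ∃[ ε ] 0# < ε ×
      All (λ q → u · q < u · p → (λ i → u i + ε * w i) · q < (λ i → u i + ε * w i) · p) ps
    perturbation = pick (forSmall-< u w p ps)

    ε : Carrier
    ε = proj₁ perturbation
    0<ε : 0# < ε
    0<ε = proj₁ (proj₂ perturbation)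
    u′ : Vector Carrier n
    u′ i = u i + ε * w i

    u′-support : ∀ {q} → q ∈ˡ ps → u′ · q ≤ u′ · p
    u′-support {q} q∈ with em {P = u · q < u · p}
    ... | yes uq<up = <⇒≤ (All.lookup (proj₂ (proj₂ perturbation)) q∈ uq<up)
    ... | no uq≮up = begin
      u′ · q              ≈⟨ ·-perturb u w ε q ⟩
      u · q + ε * (w · q) ≤⟨ +-mono-≤ (p-max q q∈A) (*-monoʳ-≤-nonNeg (<⇒≤ 0<ε)
                               (p-max′ q (q∈A , λ y y∈A → ≤.trans (p-max y y∈A) (≮⇒≥ uq≮up)))) ⟩
      u · p + ε * (w · p) ≈⟨ ·-perturb u w ε p ⟨
      u′ · p              ∎
      where
      q∈A : q ∈ A
      q∈A = All.lookup ps⊆A q∈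

    u′-max : ∀ {x} → x ∈ A → u′ · x ≤ u′ · p
    u′-max x∈A = let (q , q∈ , le) = find (supported u′ x∈A) in ≤.trans le (u′-support q∈)

  maximisers-refine-all : {A : Pred (Vector Carrier n) 0ℓ} → FinitelySupported A → Satisfiable A →
    ∀ u ws → ∃[ v ] (Maximisers v A ⊆ Maximisers u A) ×
      All (λ w → ∀ {x y} → x ∈ Maximisers v A → y ∈ Maximisers v A → w · x ≤ w · y) ws
  maximisers-refine-all A-fs A-sat u [] = u , id , []
  maximisers-refine-all A-fs A-sat u (w ∷ ws) =
    let (v , refined)        = maximisers-refine A-fs A-sat u w
        (v′ , ⊆v , constant) = maximisers-refine-all A-fs A-sat v ws
    in v′ , proj₁ ∘ refined ∘ ⊆v
     , (λ {x} x∈ y∈ → proj₂ (refined (⊆v y∈)) x (proj₁ (refined (⊆v x∈)))) ∷ constant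

  -- Refining by every coordinate functional makes all coordinates constant on the maximisers of
  -- `v`, leaving a single point: the face in direction `u` contains a vertex.
  exposed-point : {A : Pred (Vector Carrier n) 0ℓ} → FinitelySupported A → Satisfiable A →
    ∀ u → ∃[ x ] x ∈ Maximisers u A × ∃[ v ] (Maximisers v A ⊆ (_≋ x)) × x ∈ Maximisers v A
  exposed-point {n} A-fs A-sat u =
    let (v , v⊆u , constant) = maximisers-refine-all A-fs A-sat u (List.tabulate {n = n} unit)
        (x , x∈) = maximiser A-fs A-sat v
        unit-const : ∀ {y z} → y ∈ Maximisers v _ → z ∈ Maximisers v _ → ∀ i → y i ≤ z i
        unit-const {y} {z} y∈ z∈ i = begin
          y i        ≈⟨ unit-· i y ⟨
          unit i · y ≤⟨ AllP.tabulate⁻ constant i y∈ z∈ ⟩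
          unit i · z ≈⟨ unit-· i z ⟩
          z i        ∎
    in x , v⊆u x∈ , v , (λ y∈ i → ≤.antisym (unit-const y∈ x∈ i) (unit-const x∈ y∈ i)) , x∈

  -- Directions strictly separating a point from a set.

  Separators : Vector Carrier n → Pred (Vector Carrier n) 0ℓ → Pred (Vector Carrier n) 0ℓ
  Separators x A u = ∀ y → y ∈ A → u · y < u · x

  -- Separation from `A` is controlled by the finitely many points of `ps`, so it survives a small
  -- perturbation of the direction.
  separators-isOpenConvex : ∀ x {A : Pred (Vector Carrier n) 0ℓ} →
                            FinitelySupported A → IsOpenConvex (Separators x A)
  separators-isOpenConvex x {A} (ps , ps⊆A , supported) = record
    { resp   = λ {u} {v} u≋v u-sep y y∈A → begin-strict
        v · y ≈⟨ ·-congˡ u≋v y ⟨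
        u · y <⟨ u-sep y y∈A ⟩
        u · x ≈⟨ ·-congˡ u≋v x ⟩
        v · x ∎
    ; convex = convex
    ; opens  = λ {u} u-sep w →
        let (ε , 0<ε , small) = pick (forSmall-< u w x ps)
        in ε , 0<ε , λ y y∈A →
          let (p , p∈ , le) = find (supported (λ i → u i + ε * w i) y∈A)
          in begin-strict
            (λ i → u i + ε * w i) · y ≤⟨ le ⟩
            (λ i → u i + ε * w i) · p <⟨ All.lookup small p∈ (u-sep p (All.lookup ps⊆A p∈)) ⟩
            (λ i → u i + ε * w i) · x ∎
    }
    where
    convex : ∀ {α β} → 0# ≤ α → 0# ≤ β → α + β ≈ 1# → ∀ {u v} →
             u ∈ Separators x A → v ∈ Separators x A → (λ i → α * u i + β * v i) ∈ Separators x A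
    convex {α} {β} 0≤α 0≤β α+β≈1 {u} {v} u-sep v-sep y y∈A = ≰⇒> λ ge → absurd (begin
      α * (u · x) + β * (v · x)      ≈⟨ ·-combination α β u v x ⟨
      (λ i → α * u i + β * v i) · x  ≤⟨ ge ⟩
      (λ i → α * u i + β * v i) · y  ≈⟨ ·-combination α β u v y ⟩
      α * (u · y) + β * (v · y)      ∎)
      where
      absurd : ¬ α * (u · x) + β * (v · x) ≤ α * (u · y) + β * (v · y)
      -- The weights sum to 1, so at least one is positive; the strict inequality comes from that
      -- term.
      absurd ge with em {P = 0# < α}
      ... | yes 0<α = <⇒≱ (u-sep y y∈A) (*-cancelˡ-≤-pos 0<α (+-cancelʳ-≤ (β * (v · y)) (begin
        α * (u · x) + β * (v · y) ≤⟨ +-monoʳ-≤ _ (*-monoʳ-≤-nonNeg 0≤β (<⇒≤ (v-sep y y∈A))) ⟩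
        α * (u · x) + β * (v · x) ≤⟨ ge ⟩
        α * (u · y) + β * (v · y) ∎)))
      ... | no 0≮α = <⇒≱ (v-sep y y∈A) (*-cancelˡ-≤-pos 0<β (+-cancelˡ-≤ (α * (u · y)) (begin
        α * (u · y) + β * (v · x) ≤⟨ +-monoˡ-≤ _ (*-monoʳ-≤-nonNeg 0≤α (<⇒≤ (u-sep y y∈A))) ⟩
        α * (u · x) + β * (v · x) ≤⟨ ge ⟩
        α * (u · y) + β * (v · y) ∎)))
        where
        0<β : 0# < β
        0<β = begin-strict
          0#      <⟨ 0<1 ⟩
          1#      ≈⟨ α+β≈1 ⟨
          α + β   ≤⟨ +-monoˡ-≤ β (≮⇒≥ 0≮α) ⟩
          0# + β  ≈⟨ +-identityˡ β ⟩
          β       ∎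

  -- When `x` lies outside `A`, it violates one of the halfspaces defining `A`, and the normal of
  -- that halfspace separates.
  separators-satisfiable⇔ : ∀ x {A : Pred (Vector Carrier n) 0ℓ} → IsPolyhedral A →
                            Satisfiable (Separators x A) ⇔ (¬ x ∈ A)
  separators-satisfiable⇔ x {A} (H , A⊆ , ⊆A) = mk⇔
    (λ (u , u-sep) x∈A → <⇒≱ (u-sep x x∈A) ≤.refl)
    (λ x∉A → separate (λ x∈ → x∉A (⊆A x∈)))
    where
    separate : ¬ x ∈ Solutions H → Satisfiable (Separators x A)
    separate x∉ =
      let (h , h∈ , x⊭h) = find (AllP.¬All⇒Any¬ (λ h → em {P = x ⊨ h}) H x∉)
      in normal h , λ y y∈A → begin-strict
        normal h · y ≤⟨ All.lookup (A⊆ y∈A) h∈ ⟩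
        bound h      <⟨ ≰⇒> x⊭h ⟩
        normal h · x ∎

-- Support functions of convex hulls, Minkowski sums and products in `M`.

module Identities (em : ∀ {ℓ} → ExcludedMiddle ℓ) (ℝ : Reals) (d : ℕ) where

  open Reals ℝ hiding (zero) renaming (refl to ≈-refl)
  open OrderedField em ℝ
  open Weight em ℝ
  open OpenConvex em ℝ using (euler)
  open LinearInequalities em ℝ
  open Supports em ℝ
  open Polytopes em ℝ d
  open PosetReasoning poset
  open RingProperties ring using (-0#≈0#; -1*x≈-x)
  open SemiringSum semiring using (∑-comm; *-distribʳ-sum)
  open Extrema ≤-totalOrder using (argmax; f[xs]≤f[argmax])

  ·-combinationʳ : ∀ (u : W) (μ : Vector Carrier n) (p : Vector W n) →
                   u · combination μ p ≈ sum (λ i → μ i * (u · p i))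
  ·-combinationʳ u μ p = begin-equality
    sum (λ j → u j * sum (λ i → μ i * p i j))
      ≈⟨ sum-cong-≋ (λ j → *-distribˡ-sum (u j) (λ i → μ i * p i j)) ⟩
    sum (λ j → sum (λ i → u j * (μ i * p i j)))
      ≈⟨ ∑-comm (λ j i → u j * (μ i * p i j)) ⟩
    sum (λ i → sum (λ j → u j * (μ i * p i j)))
      ≈⟨ sum-cong-≋ (λ i → trans (sum-cong-≋ (λ j → x*[y*z]≈y*[x*z] (u j) (μ i) (p i j)))
                                 (sym (*-distribˡ-sum (μ i) (λ j → u j * p i j)))) ⟩
    sum (λ i → μ i * (u · p i)) ∎
    where
    open CommutativeSemigroupProperties *-commutativeSemigroup
      using () renaming (x∙yz≈y∙xz to x*[y*z]≈y*[x*z])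

  -- A functional at a convex combination is the average of its values at the generators, hence at
  -- most the largest of them.
  convexHull-finitelySupported : ∀ (p : Vector W n) → FinitelySupported (convexHull p)
  -- An empty family has empty hull, since an empty sum is not 1; it also offers no index to serve
  -- as the default of `argmax`.
  convexHull-finitelySupported {zero} p = [] , [] , λ u (_ , _ , 0≈1 , _) → contradiction 0≈1 0≉1
  convexHull-finitelySupported {suc n} p =
    List.tabulate p
    , AllP.tabulate⁺ (λ i → unit i , unit-nonNeg i , sum-unit i , λ j → sym (unit-· i (λ k → p k j)))
    , λ u {x} (μ , μ≥0 , ∑μ≈1 , x≋) →
        let m = argmax (λ i → u · p i) zero (List.allFin (suc n))
        in AnyP.tabulate⁺ {f = p} m (begin
          u · x                       ≈⟨ ·-congʳ u x≋ ⟩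
          u · combination μ p         ≈⟨ ·-combinationʳ u μ p ⟩
          sum (λ i → μ i * (u · p i)) ≤⟨ sum-mono-≤ (λ i → *-monoʳ-≤-nonNeg (μ≥0 i)
            (All.lookup (f[xs]≤f[argmax] {f = λ i → u · p i} zero (List.allFin (suc n))) (∈-allFin i))) ⟩
          sum (λ i → μ i * (u · p m)) ≈⟨ *-distribʳ-sum (u · p m) μ ⟨
          sum μ * (u · p m)           ≈⟨ *-congʳ ∑μ≈1 ⟩
          1# * (u · p m)              ≈⟨ *-identityˡ _ ⟩
          u · p m                     ∎)

  -- Real coordinates of ℂ; the identity is proved one coordinate at a time.
  record IsCoordinate (π : ℂ → Carrier) : Set where
    field
      0-homo : π 0ℂ ≈ 0#
      +-homo : ∀ z w → π (z +ℂ w) ≈ π z + π w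
      scaleˡ : ∀ z w → im z ≈ 0# → π (z *ℂ w) ≈ re z * π w
      scaleʳ : ∀ z w → im w ≈ 0# → π (z *ℂ w) ≈ re w * π z

  x-0≈x : ∀ {x y} → y ≈ 0# → x - y ≈ x
  x-0≈x {x} y≈0 = trans (+-congˡ (trans (-‿cong y≈0) -0#≈0#)) (+-identityʳ x)

  re-isCoordinate : IsCoordinate re
  re-isCoordinate = record
    { 0-homo = ≈-refl
    ; +-homo = λ _ _ → ≈-refl
    ; scaleˡ = λ z w im-z≈0 → x-0≈x (trans (*-congʳ im-z≈0) (zeroˡ (im w)))
    ; scaleʳ = λ z w im-w≈0 → trans (x-0≈x (trans (*-congˡ im-w≈0) (zeroʳ (im z)))) (*-comm _ _)
    }

  im-isCoordinate : IsCoordinate im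
  im-isCoordinate = record
    { 0-homo = ≈-refl
    ; +-homo = λ _ _ → ≈-refl
    ; scaleˡ = λ z w im-z≈0 →
        trans (+-congˡ (trans (*-congʳ im-z≈0) (zeroˡ (re w)))) (+-identityʳ _)
    ; scaleʳ = λ z w im-w≈0 →
        trans (+-congʳ (trans (*-congˡ im-w≈0) (zeroʳ (re z)))) (trans (+-identityˡ _) (*-comm _ _))
    }

  FinitelySupportedᴹ : Pred M _
  FinitelySupportedᴹ = All (λ (_ , A) → FinitelySupported (points A))

  -- h_A(u) < t for the support function h_A of A.
  Below : W → Carrier → Pred Polyhedron 0ℓ
  Below u t A = ∀ y → y ∈ points A → u · y < t

  -- Support functions add under Minkowski sum, and `p` attains the one of `A`. Multiplication by
  -- `[ A ]ᴹ` thus shifts the threshold by `u · p`, which is the form multiplicativity of the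
  -- exponential takes here.
  below-⊕ : ∀ {u t p} A B → p ∈ Maximisers u (points A) →
            (A ⊕ B) ∈ Below u t ⇔ B ∈ Below u (t - u · p)
  below-⊕ {u} {t} {p} A B (p∈A , p-max) = mk⇔
    (λ below y y∈B → ≰⇒> λ t-up≤uy → <⇒≱ (below (p +ᵥ y) (p , y , p∈A , y∈B , λ _ → ≈-refl)) (begin
      t               ≤⟨ ≤-moveˡ⁻ t-up≤uy ⟩
      u · y + u · p   ≈⟨ +-comm _ _ ⟩
      u · p + u · y   ≈⟨ ·-distribˡ u p y ⟨
      u · (p +ᵥ y)    ∎))
    (λ below x (y , z , y∈A , z∈B , x≋y+z) → ≰⇒> λ t≤ux → <⇒≱ (below z z∈B) (≤-moveˡ (begin
      t               ≤⟨ t≤ux ⟩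
      u · x           ≈⟨ ·-congʳ u x≋y+z ⟩
      u · (y +ᵥ z)    ≈⟨ ·-distribˡ u y z ⟩
      u · y + u · z   ≈⟨ +-comm _ _ ⟩
      u · z + u · y   ≤⟨ +-monoʳ-≤ (u · z) (p-max y y∈A) ⟩
      u · z + u · p   ∎)))

  -- The two conditions together give `F` and `P` the same support value in direction `u`, attained
  -- at a common point.
  Touches : W → Polyhedron → Pred Polyhedron 0ℓ
  Touches u P F = points F ⊆ points P × Satisfiable (points F ∩ Maximisers u (points P))

  product : Polyhedron → List Polyhedron → M
  product P 𝒞 = ∏ (List.map (λ F → [ P ]ᴹ -ᴹ [ F ]ᴹ) 𝒞)

  product-finitelySupported : ∀ {P 𝒞} → FinitelySupported (points P) →
    All (FinitelySupported ∘ points) 𝒞 → FinitelySupportedᴹ (product P 𝒞)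
  product-finitelySupported P-fs [] = origin-finitelySupported ∷ []
  product-finitelySupported {P} {F ∷ 𝒞} P-fs (F-fs ∷ 𝒞-fs) =
    AllP.cartesianProductWith⁺ (≡P.setoid _) (≡P.setoid _)
      (λ (b , A) (c , B) → b *ℂ c , A ⊕ B) ([ P ]ᴹ -ᴹ [ F ]ᴹ) (product P 𝒞)
      λ {x} {y} x∈ y∈ → minkowskiSum-finitelySupported
        (All.lookup factor x∈) (All.lookup (product-finitelySupported P-fs 𝒞-fs) y∈)
    where
    factor : FinitelySupportedᴹ ([ P ]ᴹ -ᴹ [ F ]ᴹ)
    factor = P-fs ∷ F-fs ∷ []

  -- Vanishing of weights, for a fixed real coordinate of the coefficients.

  module _ {π : ℂ → Carrier} (π-coordinate : IsCoordinate π) where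

    open IsCoordinate π-coordinate

    coordinates : M → List (Carrier × Polyhedron)
    coordinates = List.map (map₁ π)

    weightᴹ : Pred Polyhedron 0ℓ → M → Carrier
    weightᴹ Q f = weight Q (coordinates f)

    ⟦⟧-coordinate : ∀ f w → π (⟦ f ⟧ w) ≈ weightᴹ (λ A → w ∈ points A) f
    ⟦⟧-coordinate [] w = 0-homo
    ⟦⟧-coordinate ((c , A) ∷ f) w = trans (+-homo _ _) (+-cong term (⟦⟧-coordinate f w))
      where
      term : π (c *ℂ indicator (points A) w) ≈ π c when (w ∈ points A)
      term with em {P = w ∈ points A}
      ... | yes _ = trans (scaleʳ c 1ℂ ≈-refl) (*-identityˡ (π c))
      ... | no _  = trans (scaleʳ c 0ℂ ≈-refl) (zeroˡ (π c))

    when-scale : ∀ b c (Q : Set) → im b ≈ 0# → π (b *ℂ c) when Q ≈ re b * (π c when Q)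
    when-scale b c Q b-real with em {P = Q}
    ... | yes _ = scaleˡ b c b-real
    ... | no _  = sym (zeroʳ (re b))

    -- A coordinate of a complex product is in general not a product of coordinates, but the factors
    -- `[ P ]ᴹ -ᴹ [ F ]ᴹ` have real coefficients, and these pass through `π`.
    weightᴹ-scale : ∀ b A Q f → im b ≈ 0# →
      weightᴹ Q (List.map (λ (c , B) → b *ℂ c , A ⊕ B) f) ≈ re b * weightᴹ (λ B → Q (A ⊕ B)) f
    weightᴹ-scale b A Q [] _ = sym (zeroʳ (re b))
    weightᴹ-scale b A Q ((c , B) ∷ f) b-real =
      trans (+-cong (when-scale b c (Q (A ⊕ B)) b-real) (weightᴹ-scale b A Q f b-real))
            (sym (distribˡ (re b) _ _))

    weightᴹ-difference : ∀ P F Q f → weightᴹ Q (([ P ]ᴹ -ᴹ [ F ]ᴹ) ·ᴹ f) ≈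
      weightᴹ (λ A → Q (P ⊕ A)) f - weightᴹ (λ A → Q (F ⊕ A)) f
    weightᴹ-difference P F Q f = begin-equality
      weightᴹ Q (fP ++ fF ++ [])
        ≈⟨ reflexive (≡.cong (weight Q) (map-++ (map₁ π) fP (fF ++ []))) ⟩
      weight Q (coordinates fP ++ coordinates (fF ++ []))
        ≈⟨ weight-++ Q (coordinates fP) (coordinates (fF ++ [])) ⟩
      weightᴹ Q fP + weightᴹ Q (fF ++ [])
        ≈⟨ +-congˡ (reflexive (≡.cong (weightᴹ Q) (++-identityʳ fF))) ⟩
      weightᴹ Q fP + weightᴹ Q fF
        ≈⟨ +-cong (weightᴹ-scale 1ℂ P Q f ≈-refl) (weightᴹ-scale (-ℂ 1ℂ) F Q f -0#≈0#) ⟩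
      1# * weightᴹ (λ A → Q (P ⊕ A)) f + - 1# * weightᴹ (λ A → Q (F ⊕ A)) f
        ≈⟨ +-cong (*-identityˡ _) (-1*x≈-x _) ⟩
      weightᴹ (λ A → Q (P ⊕ A)) f - weightᴹ (λ A → Q (F ⊕ A)) f ∎
      where
      fP fF : M
      fP = List.map (λ (c , A) → 1ℂ *ℂ c , P ⊕ A) f
      fF = List.map (λ (c , A) → -ℂ 1ℂ *ℂ c , F ⊕ A) f

    -- For a touching factor, `[ P ]ᴹ` and `[ F ]ᴹ` shift the threshold equally, so their
    -- contributions cancel. Any other factor shifts the threshold of a product already known to
    -- vanish, which is why the claim covers every `t`.
    weight-below-product : ∀ u {P 𝒞} → FinitelySupported (points P) → Satisfiable (points P) →
      All (λ F → FinitelySupported (points F) × Satisfiable (points F)) 𝒞 →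
      Any (Touches u P) 𝒞 → ∀ t → weightᴹ (Below u t) (product P 𝒞) ≈ 0#
    weight-below-product u {P} {F ∷ 𝒞} _ _ _ (here (F⊆P , p , p∈F , p∈P , p-max)) t = begin-equality
      weightᴹ (Below u t) (product P (F ∷ 𝒞))
        ≈⟨ weightᴹ-difference P F (Below u t) (product P 𝒞) ⟩
      weightᴹ (λ A → Below u t (P ⊕ A)) (product P 𝒞) - weightᴹ (λ A → Below u t (F ⊕ A)) (product P 𝒞)
        ≈⟨ +-cong (weight-⇔ L λ A → below-⊕ P A (p∈P , p-max))
                  (-‿cong (weight-⇔ L λ A → below-⊕ F A (p∈F , λ y y∈F → p-max y (F⊆P y∈F)))) ⟩
      weightᴹ (Below u (t - u · p)) (product P 𝒞) - weightᴹ (Below u (t - u · p)) (product P 𝒞)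
        ≈⟨ -‿inverseʳ _ ⟩
      0# ∎
      where
      L : List (Carrier × Polyhedron)
      L = coordinates (product P 𝒞)
    weight-below-product u {P} {F ∷ 𝒞} P-fs P-sat ((F-fs , F-sat) ∷ 𝒞-fs) (there touches) t =
      begin-equality
      weightᴹ (Below u t) (product P (F ∷ 𝒞))
        ≈⟨ weightᴹ-difference P F (Below u t) (product P 𝒞) ⟩
      weightᴹ (λ A → Below u t (P ⊕ A)) (product P 𝒞) - weightᴹ (λ A → Below u t (F ⊕ A)) (product P 𝒞)
        ≈⟨ x-0≈x (vanishes F F-fs F-sat) ⟩
      weightᴹ (λ A → Below u t (P ⊕ A)) (product P 𝒞)
        ≈⟨ vanishes P P-fs P-sat ⟩
      0# ∎
      where
      vanishes : ∀ B → FinitelySupported (points B) → Satisfiable (points B) →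
                 weightᴹ (λ A → Below u t (B ⊕ A)) (product P 𝒞) ≈ 0#
      vanishes B B-fs B-sat = let (p , p∈) = maximiser B-fs B-sat u in
        trans (weight-⇔ (coordinates (product P 𝒞)) λ A → below-⊕ B A p∈)
              (weight-below-product u P-fs P-sat 𝒞-fs touches (t - u · p))

    -- The total weight is zero, because every set satisfies the bound in direction 0 with threshold
    -- 1. The sets missing `w` have weight zero by `euler` applied to their separating directions.
    -- The sets containing `w` account for the difference.
    vanishing : ∀ f → FinitelySupportedᴹ f → (∀ u t → weightᴹ (Below u t) f ≈ 0#) →
                ∀ w → weightᴹ (λ A → w ∈ points A) f ≈ 0#
    vanishing f f-fs below w = begin-equality
      weightᴹ ∋w f                  ≈⟨ +-identityʳ _ ⟨
      weightᴹ ∋w f + 0#             ≈⟨ +-congˡ outside ⟨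
      weightᴹ ∋w f + weightᴹ (∁ ∋w) f
        ≈⟨ +-cong (weight-⇔ L λ _ → mk⇔ (_ ,_) proj₂) (weight-⇔ L λ _ → mk⇔ (_ ,_) proj₂) ⟩
      weightᴹ (U ∩ ∋w) f + weightᴹ (U ∩ ∁ ∋w) f ≈⟨ weight-split U ∋w L ⟨
      weightᴹ U f                   ≈⟨ weight-⇔ L (λ _ → mk⇔ (λ _ y _ → 0ᵥ-below y) _) ⟩
      weightᴹ (Below 0ᵥ 1#) f       ≈⟨ below 0ᵥ 1# ⟩
      0#                            ∎
      where
      L : List (Carrier × Polyhedron)
      L = coordinates f

      ∋w U : Pred Polyhedron 0ℓ
      ∋w A = w ∈ points A
      U _  = ⊤

      0ᵥ-below : ∀ y → 0ᵥ · y < 1#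
      0ᵥ-below y = begin-strict
        0ᵥ · y ≈⟨ ·-zeroˡ y ⟩
        0#     <⟨ 0<1 ⟩
        1#     ∎

      outside : weightᴹ (∁ ∋w) f ≈ 0#
      outside = begin-equality
        weightᴹ (∁ ∋w) f
          ≈⟨ weight-⇔ L (λ A → separators-satisfiable⇔ w (isPolyhedral A)) ⟨
        weightᴹ (Satisfiable ∘ Separators w ∘ points) f
          ≈⟨ weight-map₂ Satisfiable (Separators w ∘ points) L ⟨
        weight Satisfiable (List.map (map₂ (Separators w ∘ points)) L)
          ≈⟨ euler d (AllP.map⁺ (AllP.map⁺ (All.map (separators-isOpenConvex w) f-fs)))
               -- Separating `w` from `A` by `u` is, by definition, lying below the threshold
               -- `u · w` in direction `u`.
               (λ u → trans (weight-map₂ (u ∈_) (Separators w ∘ points) L) (below u (u · w))) ⟩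
        0# ∎

  -- The identities for a nonempty polytope.

  face-finitelySupported : ∀ {P F : Pred W 0ℓ} → FinitelySupported P → IsFace F P → FinitelySupported F
  face-finitelySupported P-fs (u , F⊆ , ⊆F) =
    finitelySupported-resp-≐ (⊆F , F⊆) (maximisers-finitelySupported u P-fs)

  face⊆ : ∀ {P F : Pred W 0ℓ} → IsFace F P → F ⊆ P
  face⊆ (_ , F⊆ , _) x∈F = proj₁ (F⊆ x∈F)

  C̃₀⇒ID : ∀ P → IsPolytope P → Satisfiable (points P) → ∀ 𝒞 → 𝒞 ∈ C̃₀ P → ID P 𝒞
  C̃₀⇒ID P (_ , p , P≐hull) P-sat 𝒞 (_ , faces , cover) w =
    coordinate re-isCoordinate , coordinate im-isCoordinate
    where
    P-fs : FinitelySupported (points P)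
    P-fs = finitelySupported-resp-≐ (proj₂ P≐hull , proj₁ P≐hull) (convexHull-finitelySupported p)

    -- A predicate need not respect `_≋_`; for `points P` this comes from its description as a
    -- convex hull.
    maximisers-resp : ∀ u {x y} → y ≋ x → x ∈ Maximisers u (points P) → y ∈ Maximisers u (points P)
    maximisers-resp u y≋x (x∈P , x-max) =
      let (μ , μ≥0 , ∑μ≈1 , x≋) = proj₁ P≐hull x∈P
      in proj₂ P≐hull (μ , μ≥0 , ∑μ≈1 , λ i → trans (y≋x i) (x≋ i))
       , λ z z∈P → ≤.trans (x-max z z∈P) (≤.reflexive (sym (·-congʳ u y≋x)))

    touches : ∀ u → Any (Touches u P) 𝒞
    touches u =
      -- `v` exposes `x` as a vertex, which `cover` places in some `F`. Since `x` also maximises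
      -- `u`, this `F` touches `P` in direction `u`.
      let (x , x∈ , v , v⊆x , x∈v) = exposed-point P-fs P-sat u
          (F , F∈𝒞 , x∈F) = find (cover x (v , (λ y≋x → maximisers-resp v y≋x x∈v) , v⊆x))
      in lose F∈𝒞 (face⊆ (proj₁ (All.lookup faces F∈𝒞)) , x , x∈F , x∈)

    coordinate : ∀ {π} → IsCoordinate π → π (⟦ product P 𝒞 ⟧ w) ≈ π 0ℂ
    coordinate π-coordinate = trans (⟦⟧-coordinate π-coordinate (product P 𝒞) w) (trans
      (vanishing π-coordinate (product P 𝒞)
        (product-finitelySupported P-fs
          (All.map (λ (face , _) → face-finitelySupported P-fs face) faces))
        (λ u t → weight-below-product π-coordinate u P-fs P-sat
          (All.map (λ (face , sat , _) → face-finitelySupported P-fs face , sat) faces) (touches u) t)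
        w)
      (sym (IsCoordinate.0-homo π-coordinate)))

corollary4p13 : (em : ∀ {ℓ} → ExcludedMiddle ℓ) (ℝ : Reals) (d : ℕ) →
    let open Polytopes em ℝ d in
    (P : Polyhedron) → IsPolytope P → HasDimension d (points P) →
    (∀ 𝒞 → 𝒞 ∈ Minimal _≈ₛ_ (Precedes P) (Ã₀ P) → ID P 𝒞) →
    ∀ 𝒞 → 𝒞 ∈ C̃₀ P → ID P 𝒞
corollary4p13 em ℝ d P P-polytope (p , _ , p∈P , _) _ =
  -- The dimension witness lists `suc d` points of `P`, so there is at least one; the first shows
  -- that `P` is nonempty.
  Identities.C̃₀⇒ID em ℝ d P P-polytope (p zero , p∈P zero)
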